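{- Let $G=(V,E)$ be a finite connected simple graph with minimum vertex degree $\delta(G)$ and edge-connectivity $\kappa'(G)$. If $G$ has non-negative Lin-Lu-Yau curvature, then $\kappa'(G)=\delta(G)$.
   Context: All graphs are simple (no loops or multiple edges) and locally finite. The edge-connectivity $\kappa'(G)$ of a graph with at least two vertices is the minimum cardinality of an edge cut, where an edge cut is a set of edges whose deletion increases the number of connected components; the edge-connectivity of a single vertex is $0$. Let $d(x,y)$ be the combinatorial graph distance and $d_x$ the degree of $x$. For probability measures $\mu_1,\mu_2$ on $V$, the Wasserstein distance is $W(\mu_1,\mu_2)=\inf_\pi\sum_{x,y\in V}d(x,y)\pi(x,y)$, the infimum over all $\pi:V\times V\to[0,1]$ with $\sum_y\pi(x,y)=\mu_1(x)$ and $\sum_x\pi(x,y)=\mu_2(y)$ for all $x,y$. For $x\in V$ and $\rho\in[0,1]$ let $\mu_x^\rho(x)=\rho$, $\mu_x^\rho(v)=\frac{1-\rho}{d_x}$ if $v\sim x$, and $\mu_x^\rho(v)=0$ otherwise. For distinct $x,y$, $\kappa_\rho(x,y)=1-\frac{W(\mu_x^\rho,\mu_y^\rho)}{d(x,y)}$, and the Lin-Lu-Yau curvature is $\kappa_{LLY}(x,y)=\lim_{\rho\to1}\frac{\kappa_\rho(x,y)}{1-\rho}$. $G$ has non-negative Lin-Lu-Yau curvature if $\kappa_{LLY}(x,y)\ge0$ for all pairs of distinct vertices $x,y$ (equivalently, for all edges $x\sim y$). -}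

module Defs where

open import Data.Nat as ℕ using (ℕ; zero; suc)
open import Data.Fin using (Fin; zero; suc; _≟_; _<?_)
open import Data.Bool using (Bool; true; false; _∧_; _∨_; not; if_then_else_)
open import Data.Integer using (+_)
open import Data.Rational as ℚ using (ℚ; 0ℚ; 1ℚ; _/_)
open import Data.Product using (Σ; _×_; _,_)
open import Relation.Binary.PropositionalEquality using (_≡_; _≢_)
open import Relation.Nullary using (¬_; does; yes; no)

record SimpleGraph (m : ℕ) : Set where
  field
    adj   : Fin m → Fin m → Bool
    sym   : ∀ x y → adj x y ≡ adj y x
    irrefl : ∀ x → adj x x ≡ false
open SimpleGraph public

data Walk {m : ℕ} (a : Fin m → Fin m → Bool) : Fin m → Fin m → Set where
  here : ∀ {x} → Walk a x x
  step : ∀ {x y z} → a x y ≡ true → Walk a y z → Walk a x z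

ConnectedAdj : ∀ {m} → (Fin m → Fin m → Bool) → Set
ConnectedAdj a = ∀ x y → Walk a x y

Connected : ∀ {m} → SimpleGraph m → Set
Connected G = ConnectedAdj (adj G)

count : ∀ {m} → (Fin m → Bool) → ℕ
count {zero}  f = 0
count {suc m} f = (if f zero then 1 else 0) ℕ.+ count (λ i → f (suc i))

Σℕ : ∀ {m} → (Fin m → ℕ) → ℕ
Σℕ {zero}  f = 0
Σℕ {suc m} f = f zero ℕ.+ Σℕ (λ i → f (suc i))

anyF : ∀ {m} → (Fin m → Bool) → Bool
anyF {zero}  f = false
anyF {suc m} f = f zero ∨ anyF (λ i → f (suc i))

Σℚ : ∀ {m} → (Fin m → ℚ) → ℚ
Σℚ {zero}  f = 0ℚ
Σℚ {suc m} f = f zero ℚ.+ Σℚ (λ i → f (suc i))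

deg : ∀ {m} → SimpleGraph m → Fin m → ℕ
deg G x = count (adj G x)

minDeg : ∀ {n} → SimpleGraph (suc n) → ℕ
minDeg {n} G = go n (λ i → deg G i)
  where
  go : ∀ k → (Fin (suc k) → ℕ) → ℕ
  go zero    f = f zero
  go (suc k) f = f zero ℕ.⊓ go k (λ i → f (suc i))

reachWithin : ∀ {m} → SimpleGraph m → ℕ → Fin m → Fin m → Bool
reachWithin G zero    x y = does (x ≟ y)
reachWithin G (suc k) x y =
  reachWithin G k x y ∨ anyF (λ z → reachWithin G k x z ∧ adj G z y)

-- combinatorial distance d(x,y): least k ≤ m with a walk of length k
-- (the fallback value m only occurs for unreachable pairs, never in a connected graph)
dist : ∀ {m} → SimpleGraph m → Fin m → Fin m → ℕ
dist {m} G x y = search 0 m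
  where
  search : ℕ → ℕ → ℕ
  search k zero    = k
  search k (suc f) = if reachWithin G k x y then k else search (suc k) f

ℕtoℚ : ℕ → ℚ
ℕtoℚ k = (+ k) / 1

-- 1/k, with 1/0 := 0 (never used: in a connected graph with ≥ 2 vertices all degrees are ≥ 1)
inv : ℕ → ℚ
inv zero    = 0ℚ
inv (suc k) = (+ 1) / suc k

μ : ∀ {m} → SimpleGraph m → ℚ → Fin m → Fin m → ℚ
μ G ρ x v with x ≟ v
... | yes _ = ρ
... | no _  = if adj G x v then (1ℚ ℚ.- ρ) ℚ.* inv (deg G x) else 0ℚ

IsCoupling : ∀ {m} → (Fin m → ℚ) → (Fin m → ℚ) → (Fin m → Fin m → ℚ) → Set
IsCoupling μ₁ μ₂ π =
  (∀ x y → (0ℚ ℚ.≤ π x y) × (π x y ℚ.≤ 1ℚ)) ×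
  (∀ x → Σℚ (λ y → π x y) ≡ μ₁ x) ×
  (∀ y → Σℚ (λ x → π x y) ≡ μ₂ y)

cost : ∀ {m} → SimpleGraph m → (Fin m → Fin m → ℚ) → ℚ
cost G π = Σℚ (λ x → Σℚ (λ y → ℕtoℚ (dist G x y) ℚ.* π x y))

-- W(μ₁,μ₂) ≤ c, where W is the infimum of the cost over couplings:
-- for every η > 0 there is a coupling of cost ≤ c + η.
WLe : ∀ {m} → SimpleGraph m → (Fin m → ℚ) → (Fin m → ℚ) → ℚ → Set
WLe G μ₁ μ₂ c = ∀ η → 0ℚ ℚ.< η →
  Σ (Fin _ → Fin _ → ℚ) λ π → IsCoupling μ₁ μ₂ π × (cost G π ℚ.≤ c ℚ.+ η)

-- κ_LLY(x,y) ≥ 0, i.e. lim_{ρ→1} κ_ρ(x,y)/(1-ρ) ≥ 0: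
-- for every ε > 0 there is δ > 0 such that for all ρ ∈ [0,1) with ρ > 1 - δ,
-- κ_ρ(x,y)/(1-ρ) ≥ -ε, i.e. W(μ_x^ρ, μ_y^ρ) ≤ d(x,y)·(1 + ε(1-ρ)).
LLYNonNegAt : ∀ {m} → SimpleGraph m → Fin m → Fin m → Set
LLYNonNegAt G x y = ∀ ε → 0ℚ ℚ.< ε → Σ ℚ λ δ → (0ℚ ℚ.< δ) ×
  (∀ ρ → 0ℚ ℚ.≤ ρ → 1ℚ ℚ.- δ ℚ.< ρ → ρ ℚ.< 1ℚ →
     WLe G (μ G ρ x) (μ G ρ y)
       (ℕtoℚ (dist G x y) ℚ.* (1ℚ ℚ.+ ε ℚ.* (1ℚ ℚ.- ρ))))

NonNegLLY : ∀ {m} → SimpleGraph m → Set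
NonNegLLY G = ∀ x y → x ≢ y → LLYNonNegAt G x y

-- Edge sets: a Bool matrix F; the edge {u,v} is in the set iff adj u v ∧ (F u v ∨ F v u).
inSet : ∀ {m} → SimpleGraph m → (Fin m → Fin m → Bool) → Fin m → Fin m → Bool
inSet G F u v = adj G u v ∧ (F u v ∨ F v u)

deleteEdges : ∀ {m} → SimpleGraph m → (Fin m → Fin m → Bool) → Fin m → Fin m → Bool
deleteEdges G F u v = adj G u v ∧ not (F u v ∨ F v u)

edgeCount : ∀ {m} → SimpleGraph m → (Fin m → Fin m → Bool) → ℕ
edgeCount G F = Σℕ (λ u → count (λ v → does (u <? v) ∧ inSet G F u v))

-- F is an edge cut of the connected graph G: deleting it disconnects G
-- (for connected G this is exactly "increases the number of components")
IsEdgeCut : ∀ {m} → SimpleGraph m → (Fin m → Fin m → Bool) → Set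
IsEdgeCut G F = ¬ ConnectedAdj (deleteEdges G F)

EdgeConnectivityIs : ∀ {n} → SimpleGraph (suc n) → ℕ → Set
EdgeConnectivityIs {zero}  G k = k ≡ 0
EdgeConnectivityIs {suc n} G k =
  (Σ (Fin (suc (suc n)) → Fin (suc (suc n)) → Bool) λ F → IsEdgeCut G F × edgeCount G F ≡ k) ×
  (∀ F → IsEdgeCut G F → k ℕ.≤ edgeCount G F)

{-# OPTIONS --safe #-}
module Submission where

-- Non-negative curvature is used only through one inequality: for a vertex set S and an edge x y
-- leaving it (y in S), testing the transport problem against the height 1_{cl S} + 1_S + 1_{int S}
-- gives  d_x (|N(y) ∩ S| + |N(y) ∩ int S|) ≤ d_y (|N(x) ∩ cl S| + |N(x) ∩ S|).
--
-- Suppose some cut is smaller than the minimum degree; take one of minimum size κ and, among these,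
-- with Y as small as possible, so that every proper non-empty part of Y has more than κ outgoing
-- edges. Moving the boundary of Y, or of its complement X, to the other side does not shrink the cut,
-- which together with the inequality above produces cut edges x₀ y₁ and x₁ y₀ such that x₀ and y₀
-- each carry a surplus of cut edges. Counting degrees then forces equality everywhere: the cut
-- edges form a double star with centres x₀ and y₀, and the boundary vertices have degree κ + 1. The
-- inequality for Y minus y₀ leaves a single possibility, κ = 4, and then the structure propagates from
-- Y to its interior. In a finite graph this descent cannot go on for ever.

open import Defs
open import Data.Bool using (Bool; true; false; _∧_; _∨_; not; if_then_else_)
import Data.Bool.Properties as Bool
open import Data.Bool.Properties using (¬-not)
open import Data.Empty using (⊥; ⊥-elim)
open import Data.Fin using (Fin; zero; suc; _≟_; _<?_)
open import Data.Fin.Properties using (any?; <-cmp)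
import Data.Integer as ℤ
import Data.Integer.Properties as ℤ
open import Data.List using (List; []; _∷_; length)
import Data.List.Membership.DecPropositional as DecMembership
open import Data.List.Membership.Propositional using (_∈_; _∉_)
import Data.List.Relation.Unary.All as All
open import Data.List.Relation.Unary.All using (All; []; _∷_)
open import Data.List.Relation.Unary.AllPairs using ([]; _∷_)
open import Data.List.Relation.Unary.Any using (here; there)
open import Data.List.Relation.Unary.Unique.Propositional using (Unique)
open import Data.Nat using (ℕ; zero; suc; _+_; _*_; _∸_; _≤_; _<_; z≤n; s≤s; _≤?_; >-nonZero)
open import Data.Nat.Induction using (<-wellFounded)
import Data.Nat.Properties as ℕ
open import Data.Nat.Properties hiding (_≟_; _<?_; <-cmp)
open import Data.Nat.Tactic.RingSolver using (solve-∀)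
open import Data.Product using (∃; _×_; _,_; proj₁; proj₂)
open import Data.Rational as ℚ using (ℚ; 0ℚ; 1ℚ; ½; toℚᵘ)
import Data.Rational.Properties as ℚ
open import Data.Rational.Solver using (module +-*-Solver)
open import Data.Rational.Unnormalised as ℚᵘ using (mkℚᵘ; *≡*; *≤*)
import Data.Rational.Unnormalised.Properties as ℚᵘ
open import Data.Sum using (_⊎_; inj₁; inj₂)
open import Data.Unit using (⊤; tt)
open import Function using (_∘_)
open import Induction.WellFounded using (Acc; acc)
open import Relation.Binary.Definitions using (tri<; tri≈; tri>)
open import Relation.Binary.PropositionalEquality using (_≡_; _≢_; refl; trans; cong; cong₂; subst; subst₂; module ≡-Reasoning) renaming (sym to ≡-sym)
open import Relation.Nullary using (¬_; Dec; does; yes; no)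
open import Relation.Nullary.Decidable using (_×-dec_; ¬?; dec-true; dec-false)

-- On each side of the cut, κ splits into the number k of boundary vertices and an excess `Sβ`, the
-- sum of `β y`, the cut edges at y beyond the first. A boundary vertex has fewer than k boundary
-- neighbours, so a degree above κ gives it at least 1 + `Sβ` - `β y` inner neighbours, that is,
-- neighbours in the interior of its side. Hence only a vertex holding more than half of the excess
-- can have fewer inner neighbours than cut edges, and each side has at most one such vertex.
-- Curvature along a cut edge pulls the other way: with each end weighted by the degree of the
-- other, the two ends together have no more inner neighbours than cut edges, so they hold at least
-- half of the total excess. On the edges `x₀ y₁` and `x₁ y₀` one end has no excess at all, which
-- leaves no slack in the degree count. At κ = 4 this gives no contradiction yet, only a
-- configuration with five edges leaving the interior that reproduces itself one layer deeper; this
-- is where finiteness enters.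

private variable
  m : ℕ

-- Booleans, sums and counting

⟦_⟧ : Bool → ℕ
⟦ b ⟧ = if b then 1 else 0

Pred : ℕ → Set
Pred m = Fin m → Bool

∧-intro : ∀ {a b} → a ≡ true → b ≡ true → a ∧ b ≡ true
∧-intro refl refl = refl

∧-fst : ∀ {a b} → a ∧ b ≡ true → a ≡ true
∧-fst {true} _ = refl

∧-snd : ∀ {a b} → a ∧ b ≡ true → b ≡ true
∧-snd {true} p = p

not-true : ∀ {b} → not b ≡ true → b ≡ false
not-true {false} _ = refl

true≢false : ∀ {b} → b ≡ true → b ≡ false → ⊥
true≢false refl ()

⇔→≡ : ∀ {a b} → (a ≡ true → b ≡ true) → (b ≡ true → a ≡ true) → a ≡ b
⇔→≡ {true}  {b}     f g = ≡-sym (f refl)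
⇔→≡ {false} {true}  f g = g refl
⇔→≡ {false} {false} f g = refl

≟-true : {x y : Fin m} → does (x ≟ y) ≡ true → x ≡ y
≟-true {x = x} {y} p with x ≟ y
... | yes e = e

≟-refl : (x : Fin m) → does (x ≟ x) ≡ true
≟-refl x with x ≟ x
... | yes _  = refl
... | no x≢x = ⊥-elim (x≢x refl)

≟-false : {x y : Fin m} → x ≢ y → does (x ≟ y) ≡ false
≟-false {x = x} {y} x≢y with x ≟ y
... | yes e = ⊥-elim (x≢y e)
... | no _  = refl

anyF-intro : (f : Pred m) (i : Fin m) → f i ≡ true → anyF f ≡ true
anyF-intro f zero    p rewrite p = refl
anyF-intro f (suc i) p with f zero
... | true  = refl
... | false = anyF-intro (f ∘ suc) i p

anyF-elim : (f : Pred m) → anyF f ≡ true → ∃ λ i → f i ≡ true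
anyF-elim {suc m} f p with f zero in eq
... | true  = zero , eq
... | false with anyF-elim (f ∘ suc) p
...   | i , q = suc i , q

Σ-cong : {f g : Fin m → ℕ} → (∀ i → f i ≡ g i) → Σℕ f ≡ Σℕ g
Σ-cong {zero}  e = refl
Σ-cong {suc m} e = cong₂ _+_ (e zero) (Σ-cong (e ∘ suc))

Σ-mono : {f g : Fin m → ℕ} → (∀ i → f i ≤ g i) → Σℕ f ≤ Σℕ g
Σ-mono {zero}  e = z≤n
Σ-mono {suc m} e = +-mono-≤ (e zero) (Σ-mono (e ∘ suc))

Σ-zero : Σℕ {m} (λ _ → 0) ≡ 0
Σ-zero {zero}  = refl
Σ-zero {suc m} = Σ-zero {m}

+-interchange : ∀ a b c d → (a + b) + (c + d) ≡ (a + c) + (b + d)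
+-interchange = solve-∀

Σ-+ : (f g : Fin m → ℕ) → Σℕ (λ i → f i + g i) ≡ Σℕ f + Σℕ g
Σ-+ {zero}  f g = refl
Σ-+ {suc m} f g = trans (cong (f zero + g zero +_) (Σ-+ (f ∘ suc) (g ∘ suc)))
  (+-interchange (f zero) (g zero) (Σℕ (f ∘ suc)) (Σℕ (g ∘ suc)))

Σ-*ˡ : (c : ℕ) (f : Fin m → ℕ) → Σℕ (λ i → c * f i) ≡ c * Σℕ f
Σ-*ˡ {zero}  c f = ≡-sym (*-zeroʳ c)
Σ-*ˡ {suc m} c f = trans (cong (c * f zero +_) (Σ-*ˡ c (f ∘ suc))) (≡-sym (*-distribˡ-+ c _ _))

Σ-swap : ∀ {m k} (f : Fin m → Fin k → ℕ) → Σℕ (λ i → Σℕ (f i)) ≡ Σℕ (λ j → Σℕ (λ i → f i j))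
Σ-swap {zero}  {k} f = ≡-sym (Σ-zero {k})
Σ-swap {suc m} {k} f = trans (cong (Σℕ (f zero) +_) (Σ-swap (f ∘ suc)))
  (≡-sym (Σ-+ (f zero) (λ j → Σℕ (λ i → f (suc i) j))))

Σ-<⇒∃< : (f g : Fin m → ℕ) → Σℕ f < Σℕ g → ∃ λ i → f i < g i
Σ-<⇒∃< f g f<g with any? (λ i → suc (f i) ≤? g i)
... | yes w = w
... | no ¬w = ⊥-elim (<⇒≱ f<g (Σ-mono (λ i → ≮⇒≥ (λ lt → ¬w (i , lt)))))

count≡Σ : (f : Pred m) → count f ≡ Σℕ (λ i → ⟦ f i ⟧)
count≡Σ {zero}  f = refl
count≡Σ {suc m} f = cong (⟦ f zero ⟧ +_) (count≡Σ (f ∘ suc))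

⟦⟧-mono : ∀ {a b} → (a ≡ true → b ≡ true) → ⟦ a ⟧ ≤ ⟦ b ⟧
⟦⟧-mono {false} i = z≤n
⟦⟧-mono {true}  i rewrite i refl = ≤-refl

count-mono : {f g : Pred m} → (∀ i → f i ≡ true → g i ≡ true) → count f ≤ count g
count-mono {zero}  i = z≤n
count-mono {suc m} i = +-mono-≤ (⟦⟧-mono (i zero)) (count-mono (i ∘ suc))

count-cong : {f g : Pred m} → (∀ i → f i ≡ g i) → count f ≡ count g
count-cong {zero}  e = refl
count-cong {suc m} e = cong₂ _+_ (cong ⟦_⟧ (e zero)) (count-cong (e ∘ suc))

count-empty : {f : Pred m} → (∀ i → f i ≡ false) → count f ≡ 0
count-empty {zero}  e = refl
count-empty {suc m} e rewrite e zero = count-empty (e ∘ suc)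

count-split : (f g : Pred m) → count f ≡ count (λ i → f i ∧ g i) + count (λ i → f i ∧ not (g i))
count-split {zero}  f g = refl
count-split {suc m} f g = trans (cong₂ _+_ (bits (f zero) (g zero)) (count-split (f ∘ suc) (g ∘ suc)))
  (+-interchange ⟦ f zero ∧ g zero ⟧ ⟦ f zero ∧ not (g zero) ⟧ _ _)
  where
  bits : ∀ a b → ⟦ a ⟧ ≡ ⟦ a ∧ b ⟧ + ⟦ a ∧ not b ⟧
  bits false b     = refl
  bits true  false = refl
  bits true  true  = refl

count≤m : (f : Pred m) → count f ≤ m
count≤m {zero}  f = z≤n
count≤m {suc m} f with f zero
... | true  = s≤s (count≤m (f ∘ suc))
... | false = m≤n⇒m≤1+n (count≤m (f ∘ suc))

infixl 6 _−_
_−_ : Pred m → Fin m → Pred m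
(S − v) i = S i ∧ not (does (v ≟ i))

−-elim : {S : Pred m} {v i : Fin m} → (S − v) i ≡ true → S i ≡ true × v ≢ i
−-elim {S = S} {v} {i} p = ∧-fst p , λ { refl → true≢false (≟-refl v) (not-true (∧-snd {S i} p)) }

−-intro : {S : Pred m} {v i : Fin m} → S i ≡ true → v ≢ i → (S − v) i ≡ true
−-intro p v≢i = ∧-intro p (cong not (≟-false v≢i))

count-≟ : (v : Fin m) → count (λ i → does (v ≟ i)) ≡ 1
count-≟ {suc m} zero    = cong suc (count-empty {f = λ (i : Fin m) → false} (λ _ → refl))
count-≟ {suc m} (suc v) = count-≟ v

count-− : (f : Pred m) (v : Fin m) → f v ≡ true → count f ≡ suc (count (f − v))
count-− f v fv = trans (count-split f (λ i → does (v ≟ i)))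
  (cong (_+ count (f − v)) (trans (count-cong hit) (count-≟ v)))
  where
  hit : ∀ i → f i ∧ does (v ≟ i) ≡ does (v ≟ i)
  hit i = ⇔→≡ (∧-snd {f i}) (λ p → ∧-intro (subst (λ t → f t ≡ true) (≟-true {x = v} {i} p) fv) p)

count≤length : (f : Pred m) (L : List (Fin m)) → (∀ i → f i ≡ true → i ∈ L) → count f ≤ length L
count≤length f [] h = ≤-reflexive (count-empty (λ i → ¬-not (λ p → case (h i p))))
  where
  case : ∀ {i} → i ∈ [] → ⊥
  case ()
count≤length f (x ∷ L) h with f x in fx
... | true  = subst (_≤ suc (length L)) (≡-sym (count-− f x fx)) (s≤s (count≤length (f − x) L drop))
  where
  drop : ∀ i → (f − x) i ≡ true → i ∈ L
  drop i p with −-elim {S = f} p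
  ... | fi , x≢i with h i fi
  ...   | here e  = ⊥-elim (x≢i (≡-sym e))
  ...   | there q = q
... | false = m≤n⇒m≤1+n (count≤length f L drop)
  where
  drop : ∀ i → f i ≡ true → i ∈ L
  drop i p with h i p
  ... | here refl = ⊥-elim (true≢false p fx)
  ... | there q   = q

length≤count : (f : Pred m) (L : List (Fin m)) → Unique L → All (λ i → f i ≡ true) L → length L ≤ count f
length≤count f []      u a = z≤n
length≤count f (x ∷ L) (x∉ ∷ u) (fx ∷ a) = subst (suc (length L) ≤_) (≡-sym (count-− f x fx))
  (s≤s (length≤count (f − x) L u (All.zipWith (λ { (fi , x≢i) → −-intro {S = f} fi x≢i }) (a , x∉))))

count-pos : {f : Pred m} {i : Fin m} → f i ≡ true → 1 ≤ count f
count-pos {f = f} {i} p = length≤count f (i ∷ []) ([] ∷ []) (p ∷ [])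

_∈?_ : (i : Fin m) (L : List (Fin m)) → Dec (i ∈ L)
_∈?_ = DecMembership._∈?_ _≟_

fresh : (f : Pred m) (L : List (Fin m)) → length L < count f → ∃ λ i → f i ≡ true × i ∉ L
fresh f L lt with any? (λ i → (f i Bool.≟ true) ×-dec ¬? (i ∈? L))
... | yes w = w
... | no ¬w = ⊥-elim (<⇒≱ lt (count≤length f L member))
  where
  member : ∀ i → f i ≡ true → i ∈ L
  member i p with i ∈? L
  ... | yes q = q
  ... | no ¬q = ⊥-elim (¬w (i , p , ¬q))

-- Minimum degree and distance

-- The functions local to minDeg and dist have no name outside Defs; below they are recovered as
-- solutions of unification problems.

mutual
  minimum : ∀ {n} (G : SimpleGraph (suc n)) (f : Fin (suc n) → ℕ) → ℕ
  minimum = _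

  minDeg≡minimum : ∀ {n} (G : SimpleGraph (suc n)) → minDeg G ≡ minimum G (deg G)
  minDeg≡minimum G with deg G
  ... | f = refl

-- Supplies the graph argument of `minimum` in the recursive calls, where the tail of `f` lives on
-- one vertex fewer.
edgeless : ∀ {m} → SimpleGraph m
edgeless = record { adj = λ _ _ → false ; sym = λ _ _ → refl ; irrefl = λ _ → refl }

minimum-≤ : ∀ {n} (G : SimpleGraph (suc n)) f i → minimum G f ≤ f i
minimum-≤ {zero}  G f zero    = ≤-refl
minimum-≤ {suc n} G f zero    = m⊓n≤m (f zero) _
minimum-≤ {suc n} G f (suc i) = ≤-trans (m⊓n≤n (f zero) _) (minimum-≤ edgeless (f ∘ suc) i)

minimum-attained : ∀ {n} (G : SimpleGraph (suc n)) f → ∃ λ i → f i ≡ minimum G f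
minimum-attained {zero}  G f = zero , refl
minimum-attained {suc n} G f with minimum-attained {n} edgeless (f ∘ suc) | ⊓-sel (f zero) (minimum {n} edgeless (f ∘ suc))
... | i , e | inj₁ left  = zero , ≡-sym left
... | i , e | inj₂ right = suc i , trans e (≡-sym right)

minDeg-≤ : ∀ {n} (G : SimpleGraph (suc n)) x → minDeg G ≤ deg G x
minDeg-≤ G x = subst (_≤ deg G x) (≡-sym (minDeg≡minimum G)) (minimum-≤ G (deg G) x)

minDeg-attained : ∀ {n} (G : SimpleGraph (suc n)) → ∃ λ x → deg G x ≡ minDeg G
minDeg-attained G with minimum-attained G (deg G)
... | x , e = x , trans e (≡-sym (minDeg≡minimum G))

-- dist passes the number of vertices both as a parameter and as the fuel of its search. Hiding the
-- former behind an abstract definition keeps it intact while the latter is generalised.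
abstract
  size : (⊤ → ℕ) → ℕ
  size φ = suc (φ tt)

  size-const : ∀ n → size (λ _ → n) ≡ suc n
  size-const n = refl

mutual
  distance : ∀ φ (G : SimpleGraph (size φ)) (x y : Fin (size φ)) → ℕ
  distance = _

  dist≡distance : ∀ φ (G : SimpleGraph (size φ)) x y → dist G x y ≡ distance φ G x y
  dist≡distance φ G x y = refl

mutual
  distance₁ : ∀ φ (G : SimpleGraph (size φ)) (x y : Fin (size φ)) → ℕ
  distance₁ = _

  abstract
    distance-unfold : ∀ φ (G : SimpleGraph (size φ)) x y →
      distance φ G x y ≡ (if reachWithin G 0 x y then 0 else distance₁ φ G x y)
    distance-unfold φ G x y = refl

mutual
  searchFrom : ∀ φ (G : SimpleGraph (size φ)) (x y : Fin (size φ)) (k fuel : ℕ) → ℕ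
  searchFrom = _

  distance₁≡searchFrom : ∀ φ (G : SimpleGraph (size φ)) x y → distance₁ φ G x y ≡ searchFrom φ G x y 1 (φ tt)
  -- Once `1` and `φ tt` are variables, unification can read off the search as a function of both.
  -- `φ` is a function so that the fuel `φ tt` can be abstracted without occurring in `size φ`.
  distance₁≡searchFrom φ G x y with 1 | φ tt
  ... | k | fuel = refl

searchFrom-spec : ∀ φ (G : SimpleGraph (size φ)) x y k fuel →
  let r = searchFrom φ G x y k fuel in reachWithin G r x y ≡ true ⊎ r ≡ k + fuel
searchFrom-spec φ G x y k zero       = inj₂ (≡-sym (+-identityʳ k))
searchFrom-spec φ G x y k (suc fuel) with reachWithin G k x y in eq
... | true  = inj₁ eq
... | false with searchFrom-spec φ G x y (suc k) fuel
...   | inj₁ p = inj₁ p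
...   | inj₂ e = inj₂ (trans e (≡-sym (+-suc k fuel)))

abstract
  dist-spec′ : ∀ φ (G : SimpleGraph (size φ)) x y →
    reachWithin G (dist G x y) x y ≡ true ⊎ dist G x y ≡ size φ
  dist-spec′ φ G x y
    rewrite dist≡distance φ G x y | distance-unfold φ G x y | distance₁≡searchFrom φ G x y
    with reachWithin G 0 x y in eq
  ... | true  = inj₁ eq
  ... | false = searchFrom-spec φ G x y 1 (φ tt)

dist-spec : ∀ {n} (G : SimpleGraph (suc n)) x y →
  reachWithin G (dist G x y) x y ≡ true ⊎ dist G x y ≡ suc n
dist-spec {n} = subst
  (λ m → (G : SimpleGraph m) (x y : Fin m) → reachWithin G (dist G x y) x y ≡ true ⊎ dist G x y ≡ m)
  (size-const n) (dist-spec′ (λ _ → n))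

reachWithin-lipschitz : ∀ {m} (G : SimpleGraph m) (f : Fin m → ℕ) →
  (∀ u v → adj G u v ≡ true → f v ≤ suc (f u)) →
  ∀ k x y → reachWithin G k x y ≡ true → f y ≤ f x + k
reachWithin-lipschitz G f lip zero x y r rewrite ≟-true {x = x} {y} r = m≤m+n (f y) 0
reachWithin-lipschitz G f lip (suc k) x y r with reachWithin G k x y in eq
... | true  = ≤-trans (reachWithin-lipschitz G f lip k x y eq) (+-monoʳ-≤ (f x) (n≤1+n k))
... | false with anyF-elim (λ z → reachWithin G k x z ∧ adj G z y) r
...   | z , p = ≤-trans (lip z y (∧-snd {reachWithin G k x z} p))
  (subst (suc (f z) ≤_) (≡-sym (+-suc (f x) k)) (s≤s (reachWithin-lipschitz G f lip k x z (∧-fst p))))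

-- Either the search succeeds and `f` grows by at most one per step of a walk, or `dist` has its
-- fallback value, the number of vertices, which the upper bound on `f` takes care of.
dist-lipschitz : ∀ {n} (G : SimpleGraph (suc n)) (f : Fin (suc n) → ℕ) →
  (∀ u v → adj G u v ≡ true → f v ≤ suc (f u)) → (∀ v → f v ≤ suc n) →
  ∀ x y → f y ≤ f x + dist G x y
dist-lipschitz G f lip bound x y with dist-spec G x y
... | inj₁ r = reachWithin-lipschitz G f lip (dist G x y) x y r
... | inj₂ e = ≤-trans (bound y) (subst (_≤ f x + dist G x y) e (m≤n+m _ (f x)))

adj⇒≢ : ∀ {m} (G : SimpleGraph m) {x y} → adj G x y ≡ true → x ≢ y
adj⇒≢ G a refl = true≢false a (irrefl G _)

dist-adj : ∀ {m} (G : SimpleGraph m) x y → adj G x y ≡ true → dist G x y ≡ 1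
dist-adj {suc zero}    G zero zero a = ⊥-elim (adj⇒≢ G a refl)
dist-adj {suc (suc m)} G x y a
  rewrite ≟-false (adj⇒≢ G a)
        | anyF-intro (λ z → does (x ≟ z) ∧ adj G z y) x (∧-intro (≟-refl x) a) = refl

-- Transport

Σℚ-cong : {f g : Fin m → ℚ} → (∀ i → f i ≡ g i) → Σℚ f ≡ Σℚ g
Σℚ-cong {zero}  e = refl
Σℚ-cong {suc m} e = cong₂ ℚ._+_ (e zero) (Σℚ-cong (e ∘ suc))

Σℚ-mono : {f g : Fin m → ℚ} → (∀ i → f i ℚ.≤ g i) → Σℚ f ℚ.≤ Σℚ g
Σℚ-mono {zero}  e = ℚ.≤-refl
Σℚ-mono {suc m} e = ℚ.+-mono-≤ (e zero) (Σℚ-mono (e ∘ suc))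

Σℚ-zero : Σℚ {m} (λ _ → 0ℚ) ≡ 0ℚ
Σℚ-zero {zero}  = refl
Σℚ-zero {suc m} = trans (ℚ.+-identityˡ _) (Σℚ-zero {m})

Σℚ-+ : (f g : Fin m → ℚ) → Σℚ (λ i → f i ℚ.+ g i) ≡ Σℚ f ℚ.+ Σℚ g
Σℚ-+ {zero}  f g = refl
Σℚ-+ {suc m} f g = trans (cong (f zero ℚ.+ g zero ℚ.+_) (Σℚ-+ (f ∘ suc) (g ∘ suc)))
  (solve 4 (λ a b c d → (a :+ b) :+ (c :+ d) := (a :+ c) :+ (b :+ d)) refl
    (f zero) (g zero) (Σℚ (f ∘ suc)) (Σℚ (g ∘ suc)))
  where open +-*-Solver

Σℚ-*ˡ : (c : ℚ) (f : Fin m → ℚ) → Σℚ (λ i → c ℚ.* f i) ≡ c ℚ.* Σℚ f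
Σℚ-*ˡ {zero}  c f = ≡-sym (ℚ.*-zeroʳ c)
Σℚ-*ˡ {suc m} c f = trans (cong (c ℚ.* f zero ℚ.+_) (Σℚ-*ˡ c (f ∘ suc))) (≡-sym (ℚ.*-distribˡ-+ c _ _))

Σℚ-swap : ∀ {m k} (f : Fin m → Fin k → ℚ) → Σℚ (λ i → Σℚ (f i)) ≡ Σℚ (λ j → Σℚ (λ i → f i j))
Σℚ-swap {zero}  {k} f = ≡-sym (Σℚ-zero {k})
Σℚ-swap {suc m} {k} f = trans (cong (Σℚ (f zero) ℚ.+_) (Σℚ-swap (f ∘ suc)))
  (≡-sym (Σℚ-+ (f zero) (λ j → Σℚ (λ i → f (suc i) j))))

Σℚ-point : (x : Fin m) (c : ℚ) → Σℚ (λ v → if does (x ≟ v) then c else 0ℚ) ≡ c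
Σℚ-point {suc m} zero    c = trans (cong (c ℚ.+_) (Σℚ-zero {m})) (ℚ.+-identityʳ c)
Σℚ-point {suc m} (suc x) c = trans (ℚ.+-identityˡ _) (Σℚ-point x c)

toℚᵘ-ℕtoℚ : ∀ k → toℚᵘ (ℕtoℚ k) ℚᵘ.≃ mkℚᵘ (ℤ.+ k) 0
toℚᵘ-ℕtoℚ k = ℚ.toℚᵘ-fromℚᵘ (mkℚᵘ (ℤ.+ k) 0)

ℕtoℚ-+ : ∀ a b → ℕtoℚ (a + b) ≡ ℕtoℚ a ℚ.+ ℕtoℚ b
ℕtoℚ-+ a b = ℚ.toℚᵘ-injective (begin
  toℚᵘ (ℕtoℚ (a + b))                  ≈⟨ toℚᵘ-ℕtoℚ (a + b) ⟩
  mkℚᵘ (ℤ.+ (a + b)) 0                   ≈⟨ *≡* (cong (ℤ._* ℤ.+ 1) (cong₂ ℤ._+_ (≡-sym (ℤ.*-identityʳ (ℤ.+ a))) (≡-sym (ℤ.*-identityʳ (ℤ.+ b))))) ⟩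
  mkℚᵘ (ℤ.+ a) 0 ℚᵘ.+ mkℚᵘ (ℤ.+ b) 0       ≈⟨ ℚᵘ.+-cong (toℚᵘ-ℕtoℚ a) (toℚᵘ-ℕtoℚ b) ⟨
  toℚᵘ (ℕtoℚ a) ℚᵘ.+ toℚᵘ (ℕtoℚ b)     ≈⟨ ℚ.toℚᵘ-homo-+ (ℕtoℚ a) (ℕtoℚ b) ⟨
  toℚᵘ (ℕtoℚ a ℚ.+ ℕtoℚ b)             ∎)
  where open ℚᵘ.≃-Reasoning

ℕtoℚ-* : ∀ a b → ℕtoℚ (a * b) ≡ ℕtoℚ a ℚ.* ℕtoℚ b
ℕtoℚ-* a b = ℚ.toℚᵘ-injective (begin
  toℚᵘ (ℕtoℚ (a * b))                  ≈⟨ toℚᵘ-ℕtoℚ (a * b) ⟩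
  mkℚᵘ (ℤ.+ (a * b)) 0                   ≈⟨ *≡* (cong (ℤ._* ℤ.+ 1) (ℤ.pos-* a b)) ⟩
  mkℚᵘ (ℤ.+ a) 0 ℚᵘ.* mkℚᵘ (ℤ.+ b) 0       ≈⟨ ℚᵘ.*-cong (toℚᵘ-ℕtoℚ a) (toℚᵘ-ℕtoℚ b) ⟨
  toℚᵘ (ℕtoℚ a) ℚᵘ.* toℚᵘ (ℕtoℚ b)     ≈⟨ ℚ.toℚᵘ-homo-* (ℕtoℚ a) (ℕtoℚ b) ⟨
  toℚᵘ (ℕtoℚ a ℚ.* ℕtoℚ b)             ∎)
  where open ℚᵘ.≃-Reasoning

ℕtoℚ-mono : ∀ {a b} → a ≤ b → ℕtoℚ a ℚ.≤ ℕtoℚ b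
ℕtoℚ-mono {a} {b} a≤b = ℚ.toℚᵘ-cancel-≤ (begin
  toℚᵘ (ℕtoℚ a) ≃⟨ toℚᵘ-ℕtoℚ a ⟩
  mkℚᵘ (ℤ.+ a) 0  ≤⟨ *≤* (ℤ.*-monoʳ-≤-nonNeg (ℤ.+ 1) (ℤ.+≤+ a≤b)) ⟩
  mkℚᵘ (ℤ.+ b) 0  ≃⟨ toℚᵘ-ℕtoℚ b ⟨
  toℚᵘ (ℕtoℚ b) ∎)
  where open ℚᵘ.≤-Reasoning

ℕtoℚ-cancel : ∀ {a b} → ℕtoℚ a ℚ.≤ ℕtoℚ b → a ≤ b
ℕtoℚ-cancel {a} {b} h = ℤ.drop‿+≤+ (subst₂ ℤ._≤_ (ℤ.*-identityʳ (ℤ.+ a)) (ℤ.*-identityʳ (ℤ.+ b)) (ℚᵘ.drop-*≤* (begin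
  mkℚᵘ (ℤ.+ a) 0  ≃⟨ toℚᵘ-ℕtoℚ a ⟨
  toℚᵘ (ℕtoℚ a) ≤⟨ ℚ.toℚᵘ-mono-≤ h ⟩
  toℚᵘ (ℕtoℚ b) ≃⟨ toℚᵘ-ℕtoℚ b ⟩
  mkℚᵘ (ℤ.+ b) 0  ∎)))
  where open ℚᵘ.≤-Reasoning

ℕtoℚ-inv : ∀ k → 1 ≤ k → ℕtoℚ k ℚ.* inv k ≡ 1ℚ
ℕtoℚ-inv (suc k) _ = ℚ.toℚᵘ-injective (begin
  toℚᵘ (ℕtoℚ (suc k) ℚ.* inv (suc k))           ≈⟨ ℚ.toℚᵘ-homo-* (ℕtoℚ (suc k)) (inv (suc k)) ⟩
  toℚᵘ (ℕtoℚ (suc k)) ℚᵘ.* toℚᵘ (inv (suc k))   ≈⟨ ℚᵘ.*-cong (toℚᵘ-ℕtoℚ (suc k)) (ℚ.toℚᵘ-fromℚᵘ (mkℚᵘ (ℤ.+ 1) k)) ⟩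
  mkℚᵘ (ℤ.+ suc k) 0 ℚᵘ.* mkℚᵘ (ℤ.+ 1) k            ≈⟨ *≡* (trans (ℤ.*-identityʳ _) (trans (ℤ.*-identityʳ _)
    (trans (cong ℤ.+_ (≡-sym (ℕ.*-identityˡ (suc k)))) (≡-sym (ℤ.*-identityˡ _))))) ⟩
  toℚᵘ 1ℚ                                       ∎)
  where open ℚᵘ.≃-Reasoning

ℕtoℚ-Σ : (f : Fin m → ℕ) → ℕtoℚ (Σℕ f) ≡ Σℚ (ℕtoℚ ∘ f)
ℕtoℚ-Σ {zero}  f = refl
ℕtoℚ-Σ {suc m} f = trans (ℕtoℚ-+ (f zero) _) (cong (ℕtoℚ (f zero) ℚ.+_) (ℕtoℚ-Σ (f ∘ suc)))

-- There are two error terms to absorb: one from the limit defining the curvature, one from the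
-- infimum defining the Wasserstein distance.
≤-limit : ∀ {p q} → (∀ ε → 0ℚ ℚ.< ε → p ℚ.≤ q ℚ.+ (ε ℚ.+ ε)) → p ℚ.≤ q
≤-limit {p} {q} h with p ℚ.≤? q
... | yes le = le
... | no ¬le with ℚ.<-dense (ℚ.≰⇒> ¬le)
...   | r , q<r , r<p = ⊥-elim (ℚ.<-irrefl refl (ℚ.≤-<-trans (subst (p ℚ.≤_) half (h ε ε>0)) r<p))
  where
  open +-*-Solver
  gap = r ℚ.- q
  gap>0 : 0ℚ ℚ.< gap
  gap>0 = subst (ℚ._< gap) (ℚ.+-inverseʳ q) (ℚ.+-monoˡ-< (ℚ.- q) q<r)
  ε = ½ ℚ.* gap
  ε>0 : 0ℚ ℚ.< ε
  ε>0 = subst (ℚ._< ε) (ℚ.*-zeroʳ ½) (ℚ.*-monoʳ-<-pos ½ gap>0)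
  half : q ℚ.+ (ε ℚ.+ ε) ≡ r
  half = solve 2 (λ q r → q :+ (con ½ :* (r :- q) :+ con ½ :* (r :- q)) := r) refl q r

module _ {m : ℕ} (G : SimpleGraph m) where

  nbrSum : (Fin m → ℕ) → Fin m → ℕ
  nbrSum f x = Σℕ (λ v → ⟦ adj G x v ⟧ * f v)

  -- The easy half of Kantorovich duality.
  duality : (f : Fin m → ℕ) → (∀ u v → f v ≤ f u + dist G u v) →
    ∀ {μ₁ μ₂} π → IsCoupling μ₁ μ₂ π →
    Σℚ (λ v → ℕtoℚ (f v) ℚ.* μ₂ v) ℚ.≤ Σℚ (λ u → ℕtoℚ (f u) ℚ.* μ₁ u) ℚ.+ cost G π
  duality f lip {μ₁} {μ₂} π (bounds , rows , columns) = begin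
    Σℚ (λ v → F v ℚ.* μ₂ v)                         ≡⟨ Σℚ-cong (λ v → cong (F v ℚ.*_) (≡-sym (columns v))) ⟩
    Σℚ (λ v → F v ℚ.* Σℚ (λ u → π u v))             ≡⟨ Σℚ-cong (λ v → ≡-sym (Σℚ-*ˡ (F v) (λ u → π u v))) ⟩
    Σℚ (λ v → Σℚ (λ u → F v ℚ.* π u v))             ≡⟨ Σℚ-swap (λ v u → F v ℚ.* π u v) ⟩
    Σℚ (λ u → Σℚ (λ v → F v ℚ.* π u v))             ≤⟨ Σℚ-mono (λ u → Σℚ-mono (λ v → pointwise u v)) ⟩
    Σℚ (λ u → Σℚ (λ v → F u ℚ.* π u v ℚ.+ D u v ℚ.* π u v))
      ≡⟨ Σℚ-cong (λ u → trans (Σℚ-+ (λ v → F u ℚ.* π u v) (λ v → D u v ℚ.* π u v))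
          (cong (ℚ._+ Σℚ (λ v → D u v ℚ.* π u v)) (trans (Σℚ-*ˡ (F u) (π u)) (cong (F u ℚ.*_) (rows u))))) ⟩
    Σℚ (λ u → F u ℚ.* μ₁ u ℚ.+ Σℚ (λ v → D u v ℚ.* π u v)) ≡⟨ Σℚ-+ (λ u → F u ℚ.* μ₁ u) (λ u → Σℚ (λ v → D u v ℚ.* π u v)) ⟩
    Σℚ (λ u → F u ℚ.* μ₁ u) ℚ.+ cost G π             ∎
    where
    open ℚ.≤-Reasoning
    F = λ v → ℕtoℚ (f v)
    D = λ u v → ℕtoℚ (dist G u v)
    pointwise : ∀ u v → F v ℚ.* π u v ℚ.≤ F u ℚ.* π u v ℚ.+ D u v ℚ.* π u v
    pointwise u v = subst (F v ℚ.* π u v ℚ.≤_) (ℚ.*-distribʳ-+ (π u v) (F u) (D u v))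
      (ℚ.*-monoʳ-≤-nonNeg (π u v) ⦃ ℚ.nonNegative (proj₁ (bounds u v)) ⦄
        (subst (F v ℚ.≤_) (ℕtoℚ-+ (f u) (dist G u v)) (ℕtoℚ-mono (lip u v))))

  μ-sum : (f : Fin m → ℕ) → ∀ ρ x →
    Σℚ (λ v → ℕtoℚ (f v) ℚ.* μ G ρ x v) ≡
      ρ ℚ.* ℕtoℚ (f x) ℚ.+ (1ℚ ℚ.- ρ) ℚ.* (inv (deg G x) ℚ.* ℕtoℚ (nbrSum f x))
  μ-sum f ρ x = begin
    Σℚ (λ v → ℕtoℚ (f v) ℚ.* μ G ρ x v) ≡⟨ Σℚ-cong pointwise ⟩
    Σℚ (λ v → (if does (x ≟ v) then c else 0ℚ) ℚ.+ w ℚ.* ℕtoℚ (⟦ adj G x v ⟧ * f v)) ≡⟨ Σℚ-+ (λ v → if does (x ≟ v) then c else 0ℚ) (λ v → w ℚ.* ℕtoℚ (⟦ adj G x v ⟧ * f v)) ⟩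
    Σℚ (λ v → if does (x ≟ v) then c else 0ℚ) ℚ.+ Σℚ (λ v → w ℚ.* ℕtoℚ (⟦ adj G x v ⟧ * f v))
      ≡⟨ cong₂ ℚ._+_ (Σℚ-point x c) (trans (Σℚ-*ˡ w (λ v → ℕtoℚ (⟦ adj G x v ⟧ * f v))) (cong (w ℚ.*_) (≡-sym (ℕtoℚ-Σ (λ v → ⟦ adj G x v ⟧ * f v))))) ⟩
    c ℚ.+ w ℚ.* ℕtoℚ (nbrSum f x) ≡⟨ cong (c ℚ.+_) (ℚ.*-assoc (1ℚ ℚ.- ρ) _ _) ⟩
    c ℚ.+ (1ℚ ℚ.- ρ) ℚ.* (inv (deg G x) ℚ.* ℕtoℚ (nbrSum f x)) ∎
    where
    open ≡-Reasoning
    c = ρ ℚ.* ℕtoℚ (f x)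
    w = (1ℚ ℚ.- ρ) ℚ.* inv (deg G x)
    pointwise : ∀ v → ℕtoℚ (f v) ℚ.* μ G ρ x v ≡
      (if does (x ≟ v) then c else 0ℚ) ℚ.+ w ℚ.* ℕtoℚ (⟦ adj G x v ⟧ * f v)
    pointwise v with x ≟ v
    ... | yes refl rewrite irrefl G x = trans (ℚ.*-comm _ ρ)
      (trans (≡-sym (ℚ.+-identityʳ c)) (cong (c ℚ.+_) (≡-sym (ℚ.*-zeroʳ w))))
    ... | no _ with adj G x v
    ...   | true  = trans (ℚ.*-comm _ w)
      (trans (cong (λ t → w ℚ.* ℕtoℚ t) (≡-sym (ℕ.+-identityʳ (f v)))) (≡-sym (ℚ.+-identityˡ _)))
    ...   | false = trans (ℚ.*-zeroʳ (ℕtoℚ (f v)))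
      (trans (≡-sym (ℚ.*-zeroʳ w)) (≡-sym (ℚ.+-identityˡ _)))

  -- Dividing the transport inequality at ρ = 1 - τ by τ and letting the error vanish compares
  -- the averages of f over the two neighbourhoods.
  averages : NonNegLLY G → (f : Fin m → ℕ) → (∀ u v → f v ≤ f u + dist G u v) →
    ∀ {x y} → adj G x y ≡ true → f y ≡ suc (f x) →
    inv (deg G y) ℚ.* ℕtoℚ (nbrSum f y) ℚ.≤ inv (deg G x) ℚ.* ℕtoℚ (nbrSum f x) ℚ.+ 1ℚ
  averages nonNeg f lip {x} {y} x~y fy = ≤-limit bound
    where
    Ay = inv (deg G y) ℚ.* ℕtoℚ (nbrSum f y)
    Ax = inv (deg G x) ℚ.* ℕtoℚ (nbrSum f x)
    bound : ∀ ε → 0ℚ ℚ.< ε → Ay ℚ.≤ Ax ℚ.+ 1ℚ ℚ.+ (ε ℚ.+ ε)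
    bound ε ε>0 with nonNeg x y (adj⇒≢ G x~y) ε ε>0
    ... | δ , δ>0 , close = ℚ.*-cancelˡ-≤-pos τ ⦃ ℚ.positive τ>0 ⦄ scaled
      where
      open +-*-Solver
      -- The bound 1 keeps `ρ` non-negative; half of `δ` keeps it strictly above 1 - `δ`.
      τ = 1ℚ ℚ.⊓ (½ ℚ.* δ)
      ρ = 1ℚ ℚ.- τ
      half>0 : 0ℚ ℚ.< ½ ℚ.* δ
      half>0 = subst (ℚ._< ½ ℚ.* δ) (ℚ.*-zeroʳ ½) (ℚ.*-monoʳ-<-pos ½ δ>0)
      τ>0 : 0ℚ ℚ.< τ
      τ>0 with ℚ.⊓-sel 1ℚ (½ ℚ.* δ)
      ... | inj₁ e = subst (0ℚ ℚ.<_) (≡-sym e) (ℚ.positive⁻¹ 1ℚ)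
      ... | inj₂ e = subst (0ℚ ℚ.<_) (≡-sym e) half>0
      τ<δ : τ ℚ.< δ
      τ<δ = ℚ.≤-<-trans (ℚ.p⊓q≤q 1ℚ (½ ℚ.* δ)) (subst₂ ℚ._<_ (ℚ.+-identityʳ _)
        (solve 1 (λ d → con ½ :* d :+ con ½ :* d := d) refl δ) (ℚ.+-monoʳ-< (½ ℚ.* δ) half>0))
      1-ρ : 1ℚ ℚ.- ρ ≡ τ
      1-ρ = solve 1 (λ t → con 1ℚ :- (con 1ℚ :- t) := t) refl τ
      ρ≥0 : 0ℚ ℚ.≤ ρ
      ρ≥0 = subst (ℚ._≤ ρ) (ℚ.+-inverseʳ τ) (ℚ.+-monoˡ-≤ (ℚ.- τ) (ℚ.p⊓q≤p 1ℚ (½ ℚ.* δ)))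
      ρ>1-δ : 1ℚ ℚ.- δ ℚ.< ρ
      ρ>1-δ = ℚ.+-monoʳ-< 1ℚ (ℚ.neg-antimono-< τ<δ)
      ρ<1 : ρ ℚ.< 1ℚ
      ρ<1 = subst (ρ ℚ.<_) (ℚ.+-identityʳ 1ℚ) (ℚ.+-monoʳ-< 1ℚ (ℚ.neg-antimono-< τ>0))
      η>0 : 0ℚ ℚ.< τ ℚ.* ε
      η>0 = subst (ℚ._< τ ℚ.* ε) (ℚ.*-zeroʳ τ) (ℚ.*-monoʳ-<-pos τ ⦃ ℚ.positive τ>0 ⦄ ε>0)
      -- A slack proportional to `τ` survives the division by `τ` as a second `ε`.
      coupling = close ρ ρ≥0 ρ>1-δ ρ<1 (τ ℚ.* ε) η>0
      π = proj₁ coupling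
      X = ℕtoℚ (f x)
      transport : ρ ℚ.* (1ℚ ℚ.+ X) ℚ.+ τ ℚ.* Ay ℚ.≤
        ρ ℚ.* X ℚ.+ τ ℚ.* Ax ℚ.+ (1ℚ ℚ.* (1ℚ ℚ.+ ε ℚ.* τ) ℚ.+ τ ℚ.* ε)
      transport = begin
        ρ ℚ.* (1ℚ ℚ.+ X) ℚ.+ τ ℚ.* Ay
          ≡⟨ cong₂ (λ s t → ρ ℚ.* s ℚ.+ t ℚ.* Ay) (trans (≡-sym (ℕtoℚ-+ 1 (f x))) (cong ℕtoℚ (≡-sym fy))) (≡-sym 1-ρ) ⟩
        ρ ℚ.* ℕtoℚ (f y) ℚ.+ (1ℚ ℚ.- ρ) ℚ.* Ay
          ≡⟨ μ-sum f ρ y ⟨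
        Σℚ (λ v → ℕtoℚ (f v) ℚ.* μ G ρ y v)
          ≤⟨ duality f lip π (proj₁ (proj₂ coupling)) ⟩
        Σℚ (λ v → ℕtoℚ (f v) ℚ.* μ G ρ x v) ℚ.+ cost G π
          ≤⟨ ℚ.+-mono-≤ (ℚ.≤-reflexive (trans (μ-sum f ρ x) (cong (λ t → ρ ℚ.* X ℚ.+ t ℚ.* Ax) 1-ρ))) (proj₂ (proj₂ coupling)) ⟩
        ρ ℚ.* X ℚ.+ τ ℚ.* Ax ℚ.+ (ℕtoℚ (dist G x y) ℚ.* (1ℚ ℚ.+ ε ℚ.* (1ℚ ℚ.- ρ)) ℚ.+ τ ℚ.* ε)
          ≡⟨ cong₂ (λ k t → ρ ℚ.* X ℚ.+ τ ℚ.* Ax ℚ.+ (ℕtoℚ k ℚ.* (1ℚ ℚ.+ ε ℚ.* t) ℚ.+ τ ℚ.* ε)) (dist-adj G x y x~y) 1-ρ ⟩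
        ρ ℚ.* X ℚ.+ τ ℚ.* Ax ℚ.+ (1ℚ ℚ.* (1ℚ ℚ.+ ε ℚ.* τ) ℚ.+ τ ℚ.* ε) ∎
        where open ℚ.≤-Reasoning
      scaled : τ ℚ.* Ay ℚ.≤ τ ℚ.* (Ax ℚ.+ 1ℚ ℚ.+ (ε ℚ.+ ε))
      scaled = subst₂ ℚ._≤_
        (solve 3 (λ t X A → (con 1ℚ :- t) :* (con 1ℚ :+ X) :+ t :* A :+ (:- ((con 1ℚ :- t) :* (con 1ℚ :+ X))) := t :* A) refl τ X Ay)
        (solve 4 (λ t X A e → (con 1ℚ :- t) :* X :+ t :* A :+ (con 1ℚ :* (con 1ℚ :+ e :* t) :+ t :* e) :+ (:- ((con 1ℚ :- t) :* (con 1ℚ :+ X)))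
           := t :* (A :+ con 1ℚ :+ (e :+ e))) refl τ X Ax ε)
        (ℚ.+-monoˡ-≤ (ℚ.- (ρ ℚ.* (1ℚ ℚ.+ X))) transport)

  -- Clearing both denominators returns to natural numbers, where the rest of the argument takes
  -- place.
  nbrSum-compare : NonNegLLY G → (f : Fin m → ℕ) → (∀ u v → f v ≤ f u + dist G u v) →
    ∀ {x y} → adj G x y ≡ true → f y ≡ suc (f x) →
    deg G x * nbrSum f y ≤ deg G y * nbrSum f x + deg G x * deg G y
  nbrSum-compare nonNeg f lip {x} {y} x~y fy = ℕtoℚ-cancel (subst₂ ℚ._≤_ left right
    (ℚ.*-monoˡ-≤-nonNeg (dx ℚ.* dy) ⦃ ℚ.nonNegative dxdy≥0 ⦄ (averages nonNeg f lip x~y fy)))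
    where
    open +-*-Solver
    dx = ℕtoℚ (deg G x)
    dy = ℕtoℚ (deg G y)
    Sx = ℕtoℚ (nbrSum f x)
    Sy = ℕtoℚ (nbrSum f y)
    dxdy≥0 : 0ℚ ℚ.≤ dx ℚ.* dy
    dxdy≥0 = subst (0ℚ ℚ.≤_) (ℕtoℚ-* (deg G x) (deg G y)) (ℕtoℚ-mono {0} {deg G x * deg G y} z≤n)
    invx : dx ℚ.* inv (deg G x) ≡ 1ℚ
    invx = ℕtoℚ-inv (deg G x) (count-pos {f = adj G x} x~y)
    invy : dy ℚ.* inv (deg G y) ≡ 1ℚ
    invy = ℕtoℚ-inv (deg G y) (count-pos {f = adj G y} (trans (sym G y x) x~y))
    left : dx ℚ.* dy ℚ.* (inv (deg G y) ℚ.* Sy) ≡ ℕtoℚ (deg G x * nbrSum f y)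
    left = begin
      dx ℚ.* dy ℚ.* (inv (deg G y) ℚ.* Sy) ≡⟨ solve 4 (λ a b c d → a :* b :* (c :* d) := (b :* c) :* (a :* d)) refl dx dy (inv (deg G y)) Sy ⟩
      (dy ℚ.* inv (deg G y)) ℚ.* (dx ℚ.* Sy) ≡⟨ cong (ℚ._* (dx ℚ.* Sy)) invy ⟩
      1ℚ ℚ.* (dx ℚ.* Sy)                    ≡⟨ ℚ.*-identityˡ (dx ℚ.* Sy) ⟩
      dx ℚ.* Sy                            ≡⟨ ℕtoℚ-* (deg G x) (nbrSum f y) ⟨
      ℕtoℚ (deg G x * nbrSum f y)           ∎
      where open ≡-Reasoning
    right : dx ℚ.* dy ℚ.* (inv (deg G x) ℚ.* Sx ℚ.+ 1ℚ) ≡ ℕtoℚ (deg G y * nbrSum f x + deg G x * deg G y)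
    right = begin
      dx ℚ.* dy ℚ.* (inv (deg G x) ℚ.* Sx ℚ.+ 1ℚ) ≡⟨ solve 4 (λ a b c d → a :* b :* (c :* d :+ con 1ℚ) := (a :* c) :* (b :* d) :+ a :* b) refl dx dy (inv (deg G x)) Sx ⟩
      (dx ℚ.* inv (deg G x)) ℚ.* (dy ℚ.* Sx) ℚ.+ dx ℚ.* dy ≡⟨ cong (λ t → t ℚ.* (dy ℚ.* Sx) ℚ.+ dx ℚ.* dy) invx ⟩
      1ℚ ℚ.* (dy ℚ.* Sx) ℚ.+ dx ℚ.* dy       ≡⟨ cong (ℚ._+ dx ℚ.* dy) (ℚ.*-identityˡ (dy ℚ.* Sx)) ⟩
      dy ℚ.* Sx ℚ.+ dx ℚ.* dy               ≡⟨ cong₂ ℚ._+_ (≡-sym (ℕtoℚ-* (deg G y) (nbrSum f x))) (≡-sym (ℕtoℚ-* (deg G x) (deg G y))) ⟩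
      ℕtoℚ (deg G y * nbrSum f x) ℚ.+ ℕtoℚ (deg G x * deg G y) ≡⟨ ℕtoℚ-+ (deg G y * nbrSum f x) (deg G x * deg G y) ⟨
      ℕtoℚ (deg G y * nbrSum f x + deg G x * deg G y) ∎
      where open ≡-Reasoning

-- Cuts and curvature

∁ : Pred m → Pred m
∁ S i = not (S i)

⟦∧⟧ : ∀ a b → ⟦ a ∧ b ⟧ ≡ ⟦ a ⟧ * ⟦ b ⟧
⟦∧⟧ false b = refl
⟦∧⟧ true  b = ≡-sym (+-identityʳ ⟦ b ⟧)

⟦⟧≤1 : ∀ b → ⟦ b ⟧ ≤ 1
⟦⟧≤1 false = z≤n
⟦⟧≤1 true  = ≤-refl

count-point : (f : Pred m) (v : Fin m) → count (λ i → f i ∧ does (v ≟ i)) ≡ ⟦ f v ⟧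
count-point f v with f v in fv
... | true  = trans (count-cong (λ i → ⇔→≡ (∧-snd {f i}) (λ p → ∧-intro (subst (λ t → f t ≡ true) (≟-true {x = v} {i} p) fv) p))) (count-≟ v)
... | false = count-empty (λ i → ¬-not (λ p → true≢false (subst (λ t → f t ≡ true) (≡-sym (≟-true {x = v} {i} (∧-snd {f i} p))) (∧-fst p)) fv))

Σ-point : (v : Fin m) (g : Fin m → ℕ) → Σℕ (λ i → ⟦ does (v ≟ i) ⟧ * g i) ≡ g v
Σ-point {suc m} zero    g = trans (cong (1 * g zero +_) (Σ-zero {m})) (trans (+-identityʳ _) (*-identityˡ (g zero)))
Σ-point {suc m} (suc v) g = Σ-point v (g ∘ suc)

module Neighbourhoods {m : ℕ} (G : SimpleGraph m) where

  adj-sym : ∀ {u v} → adj G u v ≡ true → adj G v u ≡ true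
  adj-sym {u} {v} p = trans (sym G v u) p

  nbr : Pred m → Fin m → ℕ
  nbr S x = count (λ z → adj G x z ∧ S z)

  nbr≡Σ : ∀ S x → nbr S x ≡ Σℕ (λ z → ⟦ adj G x z ⟧ * ⟦ S z ⟧)
  nbr≡Σ S x = trans (count≡Σ (λ z → adj G x z ∧ S z)) (Σ-cong (λ z → ⟦∧⟧ (adj G x z) (S z)))

  nbr-mono : ∀ {S T} x → (∀ z → adj G x z ≡ true → S z ≡ true → T z ≡ true) → nbr S x ≤ nbr T x
  nbr-mono x i = count-mono (λ z p → ∧-intro (∧-fst p) (i z (∧-fst p) (∧-snd {adj G x z} p)))

  nbr-cong : ∀ {S T} x → (∀ z → S z ≡ T z) → nbr S x ≡ nbr T x
  nbr-cong x e = count-cong (λ z → cong (adj G x z ∧_) (e z))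

  nbr-∁ : ∀ S x → nbr S x + nbr (∁ S) x ≡ deg G x
  nbr-∁ S x = ≡-sym (count-split (adj G x) S)

  nbr-all : ∀ S x → (∀ z → adj G x z ≡ true → S z ≡ true) → nbr S x ≡ deg G x
  nbr-all S x i = count-cong (λ z → ⇔→≡ ∧-fst (λ p → ∧-intro p (i z p)))

  nbr-none : ∀ S x → (∀ z → adj G x z ≡ true → S z ≡ true → ⊥) → nbr S x ≡ 0
  nbr-none S x i = count-empty (λ z → ¬-not (λ p → i z (∧-fst p) (∧-snd {adj G x z} p)))

  nbr-split : ∀ S T x → nbr S x ≡ nbr (λ z → S z ∧ T z) x + nbr (λ z → S z ∧ not (T z)) x
  nbr-split S T x = trans (count-split (λ z → adj G x z ∧ S z) T)
    (cong₂ _+_ (count-cong (λ z → Bool.∧-assoc (adj G x z) (S z) (T z)))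
               (count-cong (λ z → Bool.∧-assoc (adj G x z) (S z) (not (T z)))))

  touches : Pred m → Pred m
  touches S v = anyF (λ z → adj G v z ∧ S z)

  int : Pred m → Pred m
  int S v = S v ∧ not (touches (∁ S) v)

  cl : Pred m → Pred m
  cl S v = S v ∨ touches S v

  touches-intro : ∀ {S v z} → adj G v z ≡ true → S z ≡ true → touches S v ≡ true
  touches-intro {S} {v} {z} a s = anyF-intro (λ z → adj G v z ∧ S z) z (∧-intro a s)

  touches-elim : ∀ {S v} → touches S v ≡ true → ∃ λ z → adj G v z ≡ true × S z ≡ true
  touches-elim {S} {v} p with anyF-elim (λ z → adj G v z ∧ S z) p
  ... | z , q = z , ∧-fst q , ∧-snd {adj G v z} q

  int⊆ : ∀ {S v} → int S v ≡ true → S v ≡ true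
  int⊆ = ∧-fst

  int-nbr : ∀ {S v z} → int S v ≡ true → adj G v z ≡ true → S z ≡ true
  int-nbr {S} {v} {z} p a with S z in eq
  ... | true  = refl
  ... | false = ⊥-elim (true≢false (touches-intro {∁ S} {v} a (cong not eq)) (not-true (∧-snd {S v} p)))

  int-intro : ∀ {S v} → S v ≡ true → (∀ z → adj G v z ≡ true → S z ≡ true) → int S v ≡ true
  int-intro {S} {v} s i = ∧-intro s (cong not (¬-not (λ t → go (touches-elim {∁ S} t))))
    where
    go : ¬ (∃ λ z → adj G v z ≡ true × ∁ S z ≡ true)
    go (z , a , q) = true≢false (i z a) (not-true q)

  ¬int : ∀ {S v} → S v ≡ true → int S v ≡ false → ∃ λ z → adj G v z ≡ true × S z ≡ false
  ¬int {S} {v} s p with touches (∁ S) v in eq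
  ... | true  = let z , a , q = touches-elim {∁ S} eq in z , a , not-true q
  ... | false rewrite s = ⊥-elim (true≢false refl p)

  cl-⊇ : ∀ {S v} → S v ≡ true → cl S v ≡ true
  cl-⊇ {S} {v} s rewrite s = refl

  cl-nbr : ∀ {S v z} → adj G v z ≡ true → S z ≡ true → cl S v ≡ true
  cl-nbr {S} {v} a s rewrite touches-intro {S} {v} a s = Bool.∨-zeroʳ (S v)

  cl-elim : ∀ {S v} → cl S v ≡ true → S v ≡ true ⊎ (∃ λ z → adj G v z ≡ true × S z ≡ true)
  cl-elim {S} {v} p with S v
  ... | true  = inj₁ refl
  ... | false = inj₂ (touches-elim {S} p)

  edges : Pred m → Pred m → ℕ
  edges P Q = Σℕ (λ u → ⟦ P u ⟧ * nbr Q u)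

  cut : Pred m → ℕ
  cut S = edges S (∁ S)

  edges-sym : ∀ P Q → edges P Q ≡ edges Q P
  edges-sym P Q = begin
    Σℕ (λ u → ⟦ P u ⟧ * nbr Q u)                                       ≡⟨ Σ-cong (λ u → expand P Q u) ⟩
    Σℕ (λ u → Σℕ (λ v → ⟦ P u ⟧ * (⟦ adj G u v ⟧ * ⟦ Q v ⟧)))          ≡⟨ Σ-swap (λ u v → ⟦ P u ⟧ * (⟦ adj G u v ⟧ * ⟦ Q v ⟧)) ⟩
    Σℕ (λ v → Σℕ (λ u → ⟦ P u ⟧ * (⟦ adj G u v ⟧ * ⟦ Q v ⟧)))          ≡⟨ Σ-cong (λ v → Σ-cong (λ u → flip u v)) ⟩
    Σℕ (λ v → Σℕ (λ u → ⟦ Q v ⟧ * (⟦ adj G v u ⟧ * ⟦ P u ⟧)))          ≡⟨ Σ-cong (λ v → ≡-sym (expand Q P v)) ⟩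
    Σℕ (λ v → ⟦ Q v ⟧ * nbr P v)                                       ∎
    where
    open ≡-Reasoning
    expand : ∀ P Q u → ⟦ P u ⟧ * nbr Q u ≡ Σℕ (λ v → ⟦ P u ⟧ * (⟦ adj G u v ⟧ * ⟦ Q v ⟧))
    expand P Q u = trans (cong (⟦ P u ⟧ *_) (nbr≡Σ Q u)) (≡-sym (Σ-*ˡ ⟦ P u ⟧ (λ v → ⟦ adj G u v ⟧ * ⟦ Q v ⟧)))
    rearrange : ∀ a b c → a * (b * c) ≡ c * (b * a)
    rearrange = solve-∀
    flip : ∀ u v → ⟦ P u ⟧ * (⟦ adj G u v ⟧ * ⟦ Q v ⟧) ≡ ⟦ Q v ⟧ * (⟦ adj G v u ⟧ * ⟦ P u ⟧)
    flip u v rewrite sym G u v = rearrange ⟦ P u ⟧ ⟦ adj G v u ⟧ ⟦ Q v ⟧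

  -- When `v` changes sides, its edges into the complement leave the cut and its edges into `S`
  -- enter it. The additive form avoids truncated subtraction.
  cut-− : ∀ S v → S v ≡ true → cut (S − v) + nbr (∁ S) v ≡ cut S + nbr S v
  cut-− S v Sv = begin
    cut (S − v) + out v                                       ≡⟨ cong (_+ out v) split ⟩
    edges (S − v) (∁ S) + nbr S v + out v                     ≡⟨ swap (edges (S − v) (∁ S)) (nbr S v) (out v) ⟩
    edges (S − v) (∁ S) + out v + nbr S v                     ≡⟨ cong (_+ nbr S v) (≡-sym whole) ⟩
    cut S + nbr S v                                           ∎
    where
    open ≡-Reasoning
    out = nbr (∁ S)
    swap : ∀ a b c → a + b + c ≡ a + c + b
    swap = solve-∀
    removed : ∀ u → nbr (∁ (S − v)) u ≡ out u + ⟦ adj G u v ⟧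
    removed u = trans (count-split (λ z → adj G u z ∧ ∁ (S − v) z) (∁ S))
      (cong₂ _+_ (count-cong old) (trans (count-cong new) (count-point (adj G u) v)))
      where
      old : ∀ z → (adj G u z ∧ ∁ (S − v) z) ∧ ∁ S z ≡ adj G u z ∧ ∁ S z
      old z with adj G u z | S z
      ... | false | _     = refl
      ... | true  | true  = Bool.∧-zeroʳ _
      ... | true  | false = refl
      new : ∀ z → (adj G u z ∧ ∁ (S − v) z) ∧ not (∁ S z) ≡ adj G u z ∧ does (v ≟ z)
      new z with v ≟ z
      ... | yes refl rewrite Sv = Bool.∧-identityʳ _
      ... | no _ with adj G u z | S z
      ...   | false | _     = refl
      ...   | true  | true  = refl
      ...   | true  | false = refl
    inside : Σℕ (λ u → ⟦ (S − v) u ⟧ * ⟦ adj G u v ⟧) ≡ nbr S v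
    inside = ≡-sym (trans (nbr≡Σ S v) (Σ-cong pointwise))
      where
      pointwise : ∀ u → ⟦ adj G v u ⟧ * ⟦ S u ⟧ ≡ ⟦ (S − v) u ⟧ * ⟦ adj G u v ⟧
      pointwise u with v ≟ u
      ... | yes refl rewrite irrefl G v = ≡-sym (*-zeroʳ ⟦ S v ∧ false ⟧)
      ... | no _ rewrite sym G v u | Bool.∧-identityʳ (S u) = *-comm ⟦ adj G u v ⟧ ⟦ S u ⟧
    split : cut (S − v) ≡ edges (S − v) (∁ S) + nbr S v
    split = begin
      Σℕ (λ u → ⟦ (S − v) u ⟧ * nbr (∁ (S − v)) u)
        ≡⟨ Σ-cong (λ u → trans (cong (⟦ (S − v) u ⟧ *_) (removed u)) (*-distribˡ-+ ⟦ (S − v) u ⟧ (out u) ⟦ adj G u v ⟧)) ⟩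
      Σℕ (λ u → ⟦ (S − v) u ⟧ * out u + ⟦ (S − v) u ⟧ * ⟦ adj G u v ⟧)
        ≡⟨ Σ-+ (λ u → ⟦ (S − v) u ⟧ * out u) (λ u → ⟦ (S − v) u ⟧ * ⟦ adj G u v ⟧) ⟩
      edges (S − v) (∁ S) + Σℕ (λ u → ⟦ (S − v) u ⟧ * ⟦ adj G u v ⟧)
        ≡⟨ cong (edges (S − v) (∁ S) +_) inside ⟩
      edges (S − v) (∁ S) + nbr S v ∎
    whole : cut S ≡ edges (S − v) (∁ S) + out v
    whole = begin
      Σℕ (λ u → ⟦ S u ⟧ * out u)
        ≡⟨ Σ-cong pointwise ⟩
      Σℕ (λ u → ⟦ (S − v) u ⟧ * out u + ⟦ does (v ≟ u) ⟧ * out u)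
        ≡⟨ Σ-+ (λ u → ⟦ (S − v) u ⟧ * out u) (λ u → ⟦ does (v ≟ u) ⟧ * out u) ⟩
      edges (S − v) (∁ S) + Σℕ (λ u → ⟦ does (v ≟ u) ⟧ * out u)
        ≡⟨ cong (edges (S − v) (∁ S) +_) (Σ-point v out) ⟩
      edges (S − v) (∁ S) + out v ∎
      where
      pointwise : ∀ u → ⟦ S u ⟧ * out u ≡ ⟦ (S − v) u ⟧ * out u + ⟦ does (v ≟ u) ⟧ * out u
      pointwise u with v ≟ u
      ... | yes refl rewrite Sv = refl
      ... | no _ rewrite Bool.∧-identityʳ (S u) = ≡-sym (+-identityʳ _)

CurvatureBound : SimpleGraph m → Set
CurvatureBound G = ∀ S {x y} → adj G x y ≡ true → S x ≡ false → S y ≡ true →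
  deg G x * (nbr S y + nbr (int S) y) ≤ deg G y * (nbr (cl S) x + nbr S x)
  where open Neighbourhoods G

module Curvature {n : ℕ} (G : SimpleGraph (suc n)) (nonNeg : NonNegLLY G) (3≤m : 3 ≤ suc n) where
  open Neighbourhoods G

  -- The test function of the transport problem is the height 1_{cl S} + 1_S + 1_{int S}.
  curvature-cut : CurvatureBound G
  curvature-cut S {x} {y} x~y x∉S y∈S = +-cancelʳ-≤ (dx * dy) _ _ (begin
    dx * (nbr S y + nbr (int S) y) + dx * dy                        ≡⟨ assemble dx dy (nbr S y) (nbr (int S) y) ⟩
    dx * (dy + nbr S y + nbr (int S) y)                             ≡⟨ cong (λ t → dx * (t + nbr S y + nbr (int S) y)) (≡-sym cl-y) ⟩
    dx * (nbr (cl S) y + nbr S y + nbr (int S) y)                   ≡⟨ cong (dx *_) (≡-sym (height-sum y)) ⟩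
    dx * nbrSum G height y                                          ≤⟨ nbrSum-compare G nonNeg height (dist-lipschitz G height lipschitz bounded) x~y step-height ⟩
    dy * nbrSum G height x + dx * dy                                ≡⟨ cong (λ t → dy * t + dx * dy) (trans (height-sum x) (trans (cong (nbr (cl S) x + nbr S x +_) int-x) (+-identityʳ _))) ⟩
    dy * (nbr (cl S) x + nbr S x) + dx * dy                         ∎)
    where
    open ≤-Reasoning
    dx = deg G x
    dy = deg G y
    assemble : ∀ a b c d → a * (c + d) + a * b ≡ a * (b + c + d)
    assemble = solve-∀
    height : Fin (suc n) → ℕ
    height v = ⟦ cl S v ⟧ + ⟦ S v ⟧ + ⟦ int S v ⟧
    y~x = adj-sym x~y
    -- The height reaches 3 on the interior, and `dist-lipschitz` asks for values up to the number
    -- of vertices only.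
    bounded : ∀ v → height v ≤ suc n
    bounded v = ≤-trans (+-mono-≤ (+-mono-≤ (⟦⟧≤1 (cl S v)) (⟦⟧≤1 (S v))) (⟦⟧≤1 (int S v))) 3≤m
    -- Each indicator at `v` is dominated by the next larger set at `u`: a neighbour of `S` lies in
    -- `cl S`, a neighbour of `int S` in `S`. Only the first indicator can gain one.
    lipschitz : ∀ u v → adj G u v ≡ true → height v ≤ suc (height u)
    lipschitz u v a = ≤-trans
      (+-mono-≤ (+-mono-≤ (⟦⟧≤1 (cl S v)) (⟦⟧-mono (cl-nbr {S} {u} a)))
                (⟦⟧-mono {int S v} {S u} (λ i → int-nbr {S} {v} {u} i (adj-sym a))))
      (s≤s (m≤m+n (⟦ cl S u ⟧ + ⟦ S u ⟧) ⟦ int S u ⟧))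
    height-x : height x ≡ 1
    height-x rewrite cl-nbr {S} {x} x~y y∈S | x∉S = refl
    y∉int : int S y ≡ false
    y∉int = ¬-not (λ i → true≢false (int-nbr {S} {y} {x} i y~x) x∉S)
    height-y : height y ≡ 2
    height-y rewrite y∉int | cl-⊇ {S} {y} y∈S | y∈S = refl
    step-height : height y ≡ suc (height x)
    step-height = trans height-y (cong suc (≡-sym height-x))
    cl-y : nbr (cl S) y ≡ dy
    cl-y = nbr-all (cl S) y (λ z a → cl-nbr {S} {z} (adj-sym a) y∈S)
    int-x : nbr (int S) x ≡ 0
    int-x = nbr-none (int S) x (λ z a i → true≢false (int-nbr {S} {z} {x} i (adj-sym a)) x∉S)
    height-sum : ∀ u → nbrSum G height u ≡ nbr (cl S) u + nbr S u + nbr (int S) u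
    height-sum u = trans (Σ-cong (λ v → distribute ⟦ adj G u v ⟧ ⟦ cl S v ⟧ ⟦ S v ⟧ ⟦ int S v ⟧))
      (trans (Σ-+ (λ v → ⟦ adj G u v ⟧ * ⟦ cl S v ⟧ + ⟦ adj G u v ⟧ * ⟦ S v ⟧) (λ v → ⟦ adj G u v ⟧ * ⟦ int S v ⟧))
        (cong₂ _+_ (trans (Σ-+ (λ v → ⟦ adj G u v ⟧ * ⟦ cl S v ⟧) (λ v → ⟦ adj G u v ⟧ * ⟦ S v ⟧))
            (cong₂ _+_ (≡-sym (nbr≡Σ (cl S) u)) (≡-sym (nbr≡Σ S u))))
          (≡-sym (nbr≡Σ (int S) u))))
      where
      distribute : ∀ a b c d → a * (b + c + d) ≡ a * b + a * c + a * d
      distribute = solve-∀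

-- The exceptional case κ = 4

-- Linear arithmetic is done by certificates: a positive combination A ≤ B of the hypotheses
-- together with a semiring identity A ≡ 1 + B + c.
infeasible : ∀ {A B} c → A ≤ B → A ≡ suc (B + c) → ⊥
infeasible {A} {B} c A≤B e = <⇒≱ (s≤s (m≤m+n B c)) (subst (_≤ B) e A≤B)

infixr 5 _⊕_
_⊕_ : ∀ {a b c d} → a ≤ b → c ≤ d → a + c ≤ b + d
_⊕_ = +-mono-≤

infixr 6 _⊗_
_⊗_ : ∀ k {a b} → a ≤ b → k * a ≤ k * b
_⊗_ k = *-monoʳ-≤ k

pattern 1st = here refl
pattern 2nd = there (here refl)
pattern 3rd = there (there (here refl))
pattern 4th = there (there (there (here refl)))

module _ {m : ℕ} (G : SimpleGraph m) where
  open Neighbourhoods G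

  nbr≤length : ∀ {S x} (L : List (Fin m)) → (∀ z → adj G x z ≡ true → S z ≡ true → z ∈ L) → nbr S x ≤ length L
  nbr≤length {S} {x} L h = count≤length _ L (λ z p → h z (∧-fst p) (∧-snd {adj G x z} p))

  length≤nbr : ∀ {S x} (L : List (Fin m)) → Unique L → All (λ z → adj G x z ≡ true × S z ≡ true) L → length L ≤ nbr S x
  length≤nbr {S} {x} L u a = length≤count _ L u (All.map (λ { (p , q) → ∧-intro p q }) a)

  nbr-fresh : ∀ {S x} (L : List (Fin m)) → length L < nbr S x → ∃ λ z → adj G x z ≡ true × S z ≡ true × z ∉ L
  nbr-fresh {S} {x} L lt with fresh _ L lt
  ... | z , p , z∉L = z , ∧-fst p , ∧-snd {adj G x z} p , z∉L

module Descent {m : ℕ} (G : SimpleGraph m) (curvature-cut : CurvatureBound G) (5≤deg : ∀ v → 5 ≤ deg G v) where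
  open Neighbourhoods G

  infix 4 _~_
  _~_ : Fin m → Fin m → Set
  u ~ v = adj G u v ≡ true

  -- The five edges leaving T are p t, q t, q q′, r t and r r′.
  record Ladder (T : Pred m) (p q r t q′ r′ : Fin m) : Set where
    field
      p∉T : T p ≡ false
      q∉T : T q ≡ false
      r∉T : T r ≡ false
      p≢q : p ≢ q
      p≢r : p ≢ r
      q≢r : q ≢ r
      boundary : ∀ {u v} → u ~ v → T u ≡ true → T v ≡ false → v ∈ p ∷ q ∷ r ∷ []
      t∈T  : T t ≡ true
      q′∈T : T q′ ≡ true
      r′∈T : T r′ ≡ true
      p~t  : p ~ t
      q~t  : q ~ t
      r~t  : r ~ t
      q~q′ : q ~ q′
      r~r′ : r ~ r′
      q′≢t : q′ ≢ t
      r′≢t : r′ ≢ t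
      from-p : ∀ {z} → p ~ z → T z ≡ true → z ≡ t
      from-q : ∀ {z} → q ~ z → T z ≡ true → z ∈ t ∷ q′ ∷ []
      from-r : ∀ {z} → r ~ z → T z ≡ true → z ∈ t ∷ r′ ∷ []
      deg-q : deg G q ≡ 5
      deg-r : deg G r ≡ 5

  -- Everything proved about `q′` is thereby available for `r′`.
  mirror : ∀ {T p q r t q′ r′} → Ladder T p q r t q′ r′ → Ladder T p r q t r′ q′
  mirror L = record
    { p∉T = p∉T ; q∉T = r∉T ; r∉T = q∉T ; p≢q = p≢r ; p≢r = p≢q ; q≢r = q≢r ∘ ≡-sym
    ; boundary = λ a u v → exchange (boundary a u v)
    ; t∈T = t∈T ; q′∈T = r′∈T ; r′∈T = q′∈T ; p~t = p~t ; q~t = r~t ; r~t = q~t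
    ; q~q′ = r~r′ ; r~r′ = q~q′ ; q′≢t = r′≢t ; r′≢t = q′≢t
    ; from-p = from-p ; from-q = from-r ; from-r = from-q ; deg-q = deg-r ; deg-r = deg-q }
    where
    open Ladder L
    exchange : ∀ {A : Set} {a b c v : A} → v ∈ a ∷ b ∷ c ∷ [] → v ∈ a ∷ c ∷ b ∷ []
    exchange 1st = 1st
    exchange 2nd = 3rd
    exchange 3rd = 2nd

  module Rung {T p q r t q′ r′} (L : Ladder T p q r t q′ r′)
              (isolated : ∀ S v → (∀ z → S z ≡ true → T z ≡ true) → S v ≡ true → 5 ≤ cut S) where
    open Ladder L

    rim : Pred m
    rim z = T z ∧ not (int T z)

    rim-elim : ∀ {z} → rim z ≡ true → z ∈ t ∷ q′ ∷ r′ ∷ []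
    rim-elim {z} e with ¬int {T} {z} (∧-fst e) (not-true (∧-snd {T z} e))
    ... | w , a , w∉T with boundary a (∧-fst e) w∉T
    ...   | 1st = subst (_∈ _) (≡-sym (from-p (adj-sym a) (∧-fst e))) 1st
    ...   | 2nd with from-q (adj-sym a) (∧-fst e)
    ...     | 1st = 1st
    ...     | 2nd = 2nd
    rim-elim {z} e | w , a , w∉T | 3rd with from-r (adj-sym a) (∧-fst e)
    ...     | 1st = 1st
    ...     | 2nd = 3rd

    nbr-rim : ∀ x → nbr T x ≡ nbr (int T) x + nbr rim x
    nbr-rim x = trans (nbr-split T (int T) x) (cong (_+ nbr rim x)
      (nbr-cong x (λ z → ⇔→≡ (∧-snd {T z}) (λ i → ∧-intro (int⊆ {T} i) i))))

    nbr-p : nbr T p ≤ 1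
    nbr-p = nbr≤length G (t ∷ []) (λ z a s → subst (_∈ _) (≡-sym (from-p a s)) 1st)

    nbr-q : nbr T q ≤ 2
    nbr-q = nbr≤length G (t ∷ q′ ∷ []) (λ z a s → from-q a s)

    nbr-r : nbr T r ≤ 2
    nbr-r = nbr≤length G (t ∷ r′ ∷ []) (λ z a s → from-r a s)

    cut≤5 : cut T ≤ 5
    cut≤5 = begin
      cut T                          ≡⟨ edges-sym T (∁ T) ⟩
      edges (∁ T) T                  ≤⟨ Σ-mono pointwise ⟩
      Σℕ (λ u → at p 1 u + at q 2 u + at r 2 u) ≡⟨ Σ-+ (λ u → at p 1 u + at q 2 u) (at r 2) ⟩
      Σℕ (λ u → at p 1 u + at q 2 u) + Σℕ (at r 2) ≡⟨ cong₂ _+_ (Σ-+ (at p 1) (at q 2)) (Σ-point r (λ _ → 2)) ⟩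
      Σℕ (at p 1) + Σℕ (at q 2) + 2  ≡⟨ cong₂ (λ a b → a + b + 2) (Σ-point p (λ _ → 1)) (Σ-point q (λ _ → 2)) ⟩
      5                              ∎
      where
      open ≤-Reasoning
      at : Fin m → ℕ → Fin m → ℕ
      at w k u = ⟦ does (w ≟ u) ⟧ * k
      at-self : ∀ w k → at w k w ≡ k
      at-self w k rewrite ≟-refl w = *-identityˡ k
      pointwise : ∀ u → ⟦ ∁ T u ⟧ * nbr T u ≤ at p 1 u + at q 2 u + at r 2 u
      pointwise u with T u in u∈T
      ... | true  = z≤n
      ... | false with u ∈? (p ∷ q ∷ r ∷ [])
      ...   | yes 1st = subst (_≤ at p 1 p + at q 2 p + at r 2 p) (≡-sym (*-identityˡ _))
        (≤-trans nbr-p (≤-trans (≤-reflexive (≡-sym (at-self p 1))) (≤-trans (m≤m+n _ _) (m≤m+n _ _))))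
      ...   | yes 2nd = subst (_≤ at p 1 q + at q 2 q + at r 2 q) (≡-sym (*-identityˡ _))
        (≤-trans nbr-q (≤-trans (≤-reflexive (≡-sym (at-self q 2))) (≤-trans (m≤n+m _ (at p 1 q)) (m≤m+n _ _))))
      ...   | yes 3rd = subst (_≤ at p 1 r + at q 2 r + at r 2 r) (≡-sym (*-identityˡ _))
        (≤-trans nbr-r (≤-trans (≤-reflexive (≡-sym (at-self r 2))) (m≤n+m _ (at p 1 r + at q 2 r))))
      ...   | no u∉ = subst (_≤ at p 1 u + at q 2 u + at r 2 u)
        (≡-sym (trans (*-identityˡ _) (nbr-none T u (λ z a s → u∉ (boundary (adj-sym a) s u∈T))))) z≤n

    out-t : nbr (∁ T) t ≡ 3
    out-t = ≤-antisym
      (nbr≤length G (p ∷ q ∷ r ∷ []) (λ z a s → boundary a t∈T (not-true s)))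
      (length≤nbr G (p ∷ q ∷ r ∷ []) ((p≢q ∷ p≢r ∷ []) ∷ (q≢r ∷ []) ∷ [] ∷ [])
        ((adj-sym p~t , cong not p∉T) ∷ (adj-sym q~t , cong not q∉T) ∷ (adj-sym r~t , cong not r∉T) ∷ []))

    deg-t : deg G t ≡ nbr T t + 3
    deg-t = trans (≡-sym (nbr-∁ T t)) (cong (nbr T t +_) out-t)

    -- Removing `t` drops three of at most five cut edges, yet `T − t` still contains `q′` and so
    -- has at least five; the edges from `t` into `T` must make up the difference.
    3≤nbr-t : 3 ≤ nbr T t
    3≤nbr-t = +-cancelˡ-≤ 5 3 (nbr T t) (begin
      5 + 3               ≤⟨ +-monoˡ-≤ 3 (isolated (T − t) q′ (λ z s → proj₁ (−-elim {S = T} {t} {z} s)) (−-intro {S = T} q′∈T (q′≢t ∘ ≡-sym))) ⟩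
      cut (T − t) + 3     ≡⟨ cong (cut (T − t) +_) (≡-sym out-t) ⟩
      cut (T − t) + nbr (∁ T) t ≡⟨ cut-− T t t∈T ⟩
      cut T + nbr T t     ≤⟨ +-monoˡ-≤ (nbr T t) cut≤5 ⟩
      5 + nbr T t         ∎)
      where open ≤-Reasoning

    curvature-pt : 5 * (nbr T t + nbr (int T) t) ≤ (nbr T t + 3) * 4
    curvature-pt = begin
      5 * (nbr T t + nbr (int T) t)           ≤⟨ *-monoˡ-≤ (nbr T t + nbr (int T) t) (5≤deg p) ⟩
      deg G p * (nbr T t + nbr (int T) t)     ≤⟨ curvature-cut T p~t p∉T t∈T ⟩
      deg G t * (nbr (cl T) p + nbr T p)      ≤⟨ *-monoʳ-≤ (deg G t) (+-mono-≤ closure nbr-p) ⟩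
      deg G t * 4                             ≡⟨ cong (_* 4) deg-t ⟩
      (nbr T t + 3) * 4                       ∎
      where
      open ≤-Reasoning
      closure : nbr (cl T) p ≤ 3
      closure = nbr≤length G (t ∷ q ∷ r ∷ []) member
        where
        member : ∀ z → p ~ z → cl T z ≡ true → z ∈ t ∷ q ∷ r ∷ []
        member z a c with T z in z∈T
        ... | true  = subst (_∈ _) (≡-sym (from-p a z∈T)) 1st
        ... | false with touches-elim {T} {z} c
        ...   | w , b , w∈T with boundary (adj-sym b) w∈T z∈T
        ...     | 1st = ⊥-elim (adj⇒≢ G a refl)
        ...     | 2nd = 2nd
        ...     | 3rd = 3rd

    rim-t-⊆ : ∀ {z} → t ~ z → rim z ≡ true → z ∈ q′ ∷ r′ ∷ []
    rim-t-⊆ a e with rim-elim e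
    ... | 1st = ⊥-elim (adj⇒≢ G a refl)
    ... | there z∈ = z∈

    nbr-t≤ : nbr T t ≤ nbr (int T) t + 2
    nbr-t≤ = ≤-trans (≤-reflexive (nbr-rim t)) (+-monoʳ-≤ (nbr (int T) t) (nbr≤length G (q′ ∷ r′ ∷ []) (λ z → rim-t-⊆)))

    -- Let `t` have N neighbours in `T`, o of them interior. Curvature along `p t` reads N + 5o ≤
    -- 12, so N ≥ 3 excludes o ≥ 2, and N ≤ o + 2 excludes o = 0.
    int-t : nbr (int T) t ≡ 1
    int-t = ≤-antisym (≮⇒≥ (λ 2≤o → infeasible 0 (curvature-pt ⊕ 3≤nbr-t ⊕ 5 ⊗ 2≤o) (combine (nbr T t) (nbr (int T) t))))
      (+-cancelʳ-≤ 2 1 (nbr (int T) t) (≤-trans 3≤nbr-t nbr-t≤))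
      where
      combine : ∀ N o → 5 * (N + o) + (3 + 5 * 2) ≡ suc ((N + 3) * 4 + (N + 5 * o) + 0)
      combine = solve-∀

    2≤rim-t : 2 ≤ nbr rim t
    2≤rim-t = +-cancelˡ-≤ 1 2 (nbr rim t) (≤-trans 3≤nbr-t (≤-reflexive (trans (nbr-rim t) (cong (_+ nbr rim t) int-t))))

    -- `t` has two neighbours on the rim, and `q′` and `r′` are the only candidates.
    q′≢r′ : q′ ≢ r′
    q′≢r′ refl = <⇒≱ 2≤rim-t (nbr≤length G (q′ ∷ []) (λ z a e → only (rim-t-⊆ a e)))
      where
      only : ∀ {z} → z ∈ q′ ∷ q′ ∷ [] → z ∈ q′ ∷ []
      only 1st = 1st
      only 2nd = 1st

    t∉int : int T t ≡ false
    t∉int = ¬-not (λ i → true≢false (int-nbr {T} i (adj-sym p~t)) p∉T)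

    q′∉int : int T q′ ≡ false
    q′∉int = ¬-not (λ i → true≢false (int-nbr {T} i (adj-sym q~q′)) q∉T)

    outside-q′ : ∀ {z} → q′ ~ z → T z ≡ false → z ≡ q
    outside-q′ a z∉T with boundary a q′∈T z∉T
    ... | 1st = ⊥-elim (q′≢t (from-p (adj-sym a) q′∈T))
    ... | 2nd = refl
    ... | 3rd with from-r (adj-sym a) q′∈T
    ...   | 1st = ⊥-elim (q′≢t refl)
    ...   | 2nd = ⊥-elim (q′≢r′ refl)

    deg-q′≤ : deg G q′ ≤ nbr T q′ + 1
    deg-q′≤ = ≤-trans (≤-reflexive (≡-sym (nbr-∁ T q′)))
      (+-monoʳ-≤ (nbr T q′) (nbr≤length G (q ∷ []) (λ z a s → subst (_∈ _) (≡-sym (outside-q′ a (not-true s))) 1st)))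

    nbr-q′≤ : nbr T q′ ≤ nbr (int T) q′ + 2
    nbr-q′≤ = ≤-trans (≤-reflexive (nbr-rim q′)) (+-monoʳ-≤ (nbr (int T) q′) (nbr≤length G (t ∷ r′ ∷ []) (λ z a e → member a (rim-elim e))))
      where
      member : ∀ {z} → q′ ~ z → z ∈ t ∷ q′ ∷ r′ ∷ [] → z ∈ t ∷ r′ ∷ []
      member a 1st = 1st
      member a 2nd = ⊥-elim (adj⇒≢ G a refl)
      member a 3rd = 2nd

    curvature-qq′ : 5 * (nbr T q′ + nbr (int T) q′) ≤ (nbr T q′ + 1) * 6
    curvature-qq′ = begin
      5 * (nbr T q′ + nbr (int T) q′)         ≡⟨ cong (_* (nbr T q′ + nbr (int T) q′)) (≡-sym deg-q) ⟩
      deg G q * (nbr T q′ + nbr (int T) q′)   ≤⟨ curvature-cut T q~q′ q∉T q′∈T ⟩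
      deg G q′ * (nbr (cl T) q + nbr T q)     ≤⟨ *-mono-≤ deg-q′≤ (+-mono-≤ closure nbr-q) ⟩
      (nbr T q′ + 1) * 6                      ∎
      where
      open ≤-Reasoning
      closure : nbr (cl T) q ≤ 4
      closure = nbr≤length G (t ∷ q′ ∷ p ∷ r ∷ []) member
        where
        member : ∀ z → q ~ z → cl T z ≡ true → z ∈ t ∷ q′ ∷ p ∷ r ∷ []
        member z a c with T z in z∈T
        ... | true with from-q a z∈T
        ...   | 1st = 1st
        ...   | 2nd = 2nd
        member z a c | false with touches-elim {T} {z} c
        ...   | w , b , w∈T with boundary (adj-sym b) w∈T z∈T
        ...     | 1st = 3rd
        ...     | 2nd = ⊥-elim (adj⇒≢ G a refl)
        ...     | 3rd = 4th

    2≤int-q′ : 2 ≤ nbr (int T) q′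
    2≤int-q′ = +-cancelʳ-≤ 3 2 (nbr (int T) q′) (≤-trans (5≤deg q′) (≤-trans deg-q′≤
      (≤-trans (+-monoˡ-≤ 1 nbr-q′≤) (≤-reflexive (+-assoc (nbr (int T) q′) 2 1)))))

    -- With N and o as before but counted at `q′`, curvature along `q q′` gives 5o ≤ N + 6, and N ≤
    -- o + 2 turns this into o ≤ 2. The minimum degree gives 5 ≤ N + 1, hence o ≥ 2.
    int-q′ : nbr (int T) q′ ≡ 2
    int-q′ = ≤-antisym (≮⇒≥ (λ 3≤o → infeasible 3 (curvature-qq′ ⊕ 4 ⊗ 3≤o ⊕ nbr-q′≤) (combine (nbr T q′) (nbr (int T) q′)))) 2≤int-q′
      where
      combine : ∀ N o → 5 * (N + o) + (4 * 3 + N) ≡ suc ((N + 1) * 6 + (4 * o + (o + 2)) + 3)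
      combine = solve-∀

    deg-q′ : deg G q′ ≡ 5
    deg-q′ = ≤-antisym (≤-trans deg-q′≤ (+-monoˡ-≤ 1 (subst (λ o → nbr T q′ ≤ o + 2) int-q′ nbr-q′≤))) (5≤deg q′)

    module _ {t₁} (t~t₁ : t ~ t₁) (t₁∈int : int T t₁ ≡ true) where

      from-t : ∀ {z} → t ~ z → int T z ≡ true → z ≡ t₁
      from-t {z} a i with z ≟ t₁
      ... | yes e   = e
      ... | no z≢t₁ = ⊥-elim (<⇒≱ (length≤nbr G {int T} {t} (z ∷ t₁ ∷ []) ((z≢t₁ ∷ []) ∷ [] ∷ []) ((a , i) ∷ (t~t₁ , t₁∈int) ∷ [])) (≤-reflexive int-t))

      -- Otherwise the cut around T − t has negative curvature along q q′.
      q′~t₁ : q′ ~ t₁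
      q′~t₁ with adj G q′ t₁ in eq
      ... | true  = refl
      ... | false = ⊥-elim (infeasible 0 (2≤inner ⊕ 3≤nbr ⊕ curved) (combine (nbr T₁ q′) (nbr (int T₁) q′)))
        where
        T₁ = T − t
        combine : ∀ N o → 2 + (3 + (N + o)) ≡ suc (o + (N + 4) + 0)
        combine = solve-∀
        q′∈T₁ : T₁ q′ ≡ true
        q′∈T₁ = −-intro {S = T} q′∈T (q′≢t ∘ ≡-sym)
        q∉T₁ : T₁ q ≡ false
        q∉T₁ = cong (_∧ not (does (t ≟ q))) q∉T
        ∉T₁ : ∀ {z} → T₁ z ≡ false → T z ≡ false ⊎ z ≡ t
        ∉T₁ {z} e with T z in z∈T
        ... | false = inj₁ refl
        ... | true with t ≟ z
        ...   | yes refl = inj₂ refl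
        2≤inner : 2 ≤ nbr (int T₁) q′
        2≤inner = ≤-trans 2≤int-q′ (nbr-mono {int T} {int T₁} q′ keep)
          where
          -- An interior neighbour of `t` can only be `t₁`, which is assumed not to be adjacent to
          -- `q′`; so removing `t` costs `q′` no interior neighbour.
          keep : ∀ z → q′ ~ z → int T z ≡ true → int T₁ z ≡ true
          keep z a i = int-intro {T₁} {z} (−-intro {S = T} {t} {z} (int⊆ {T} i) (λ { refl → true≢false i t∉int }))
            (λ w b → −-intro {S = T} {t} {w} (int-nbr {T} {z} {w} i b) (λ { refl → true≢false (subst (q′ ~_) (from-t (adj-sym b) i) a) eq }))
        3≤nbr : 3 ≤ nbr T₁ q′
        3≤nbr = +-cancelʳ-≤ 2 3 (nbr T₁ q′) (≤-trans (≤-reflexive (trans (≡-sym deg-q′) (≡-sym (nbr-∁ T₁ q′))))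
          (+-monoʳ-≤ (nbr T₁ q′) (nbr≤length G (q ∷ t ∷ []) (λ z a s → member a (∉T₁ {z} (not-true s))))))
          where
          member : ∀ {z} → q′ ~ z → T z ≡ false ⊎ z ≡ t → z ∈ q ∷ t ∷ []
          member a (inj₁ z∉T) = subst (_∈ _) (≡-sym (outside-q′ a z∉T)) 1st
          member a (inj₂ refl) = 2nd
        from-q₁ : ∀ {z} → q ~ z → T₁ z ≡ true → z ≡ q′
        from-q₁ {z} a s with −-elim {S = T} {t} {z} s
        ... | z∈T , t≢z with from-q a z∈T
        ...   | 1st = ⊥-elim (t≢z refl)
        ...   | 2nd = refl
        -- One less than for `T`: the only neighbour of `p` in `T` is `t`, so `p` leaves the
        -- closure.
        closure : nbr (cl T₁) q ≤ 3
        closure = nbr≤length G (q′ ∷ t ∷ r ∷ []) member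
          where
          member : ∀ z → q ~ z → cl T₁ z ≡ true → z ∈ q′ ∷ t ∷ r ∷ []
          member z a c with cl-elim {T₁} {z} c
          ... | inj₁ s = subst (_∈ _) (≡-sym (from-q₁ a s)) 1st
          ... | inj₂ (w , b , w∈T₁) with T z in z∈T | −-elim {S = T} {t} {w} w∈T₁
          ...   | true  | _ with from-q a z∈T
          ...     | 1st = 2nd
          ...     | 2nd = 1st
          member z a c | inj₂ (w , b , w∈T₁) | false | w∈T , t≢w with boundary (adj-sym b) w∈T z∈T
          ...     | 1st = ⊥-elim (t≢w (≡-sym (from-p b w∈T)))
          ...     | 2nd = ⊥-elim (adj⇒≢ G a refl)
          ...     | 3rd = 3rd
        curved : nbr T₁ q′ + nbr (int T₁) q′ ≤ 4
        curved = *-cancelˡ-≤ 5 (begin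
          5 * (nbr T₁ q′ + nbr (int T₁) q′)       ≡⟨ cong (_* (nbr T₁ q′ + nbr (int T₁) q′)) (≡-sym deg-q) ⟩
          deg G q * (nbr T₁ q′ + nbr (int T₁) q′) ≤⟨ curvature-cut T₁ q~q′ q∉T₁ q′∈T₁ ⟩
          deg G q′ * (nbr (cl T₁) q + nbr T₁ q)   ≡⟨ cong (_* (nbr (cl T₁) q + nbr T₁ q)) deg-q′ ⟩
          5 * (nbr (cl T₁) q + nbr T₁ q)          ≤⟨ *-monoʳ-≤ 5 (+-mono-≤ closure (nbr≤length G (q′ ∷ []) (λ z a s → subst (_∈ _) (≡-sym (from-q₁ a s)) 1st))) ⟩
          5 * 4                                   ∎)
          where open ≤-Reasoning

      exhaust-q′ : ∀ {q₁} → q′ ~ q₁ → int T q₁ ≡ true → q₁ ∉ t₁ ∷ [] → ∀ {z} → q′ ~ z → int T z ≡ true → z ∈ t₁ ∷ q₁ ∷ []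
      exhaust-q′ {q₁} a i q₁∉ {z} b j with z ∈? (t₁ ∷ q₁ ∷ [])
      ... | yes z∈ = z∈
      ... | no z∉ = ⊥-elim (<⇒≱ (length≤nbr G {int T} {q′} (z ∷ t₁ ∷ q₁ ∷ [])
          (((λ e → z∉ (here e)) ∷ (λ e → z∉ (there (here e))) ∷ []) ∷ ((λ e → q₁∉ (here (≡-sym e))) ∷ []) ∷ [] ∷ [])
          ((b , j) ∷ (q′~t₁ , t₁∈int) ∷ (a , i) ∷ [])) (≤-reflexive int-q′))

      Next-q′ : Set
      Next-q′ = ∃ λ q₁ → q′ ~ q₁ × int T q₁ ≡ true × q₁ ≢ t₁ × (∀ {z} → q′ ~ z → int T z ≡ true → z ∈ t₁ ∷ q₁ ∷ [])

      next-q′ : Next-q′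
      next-q′ = extend (nbr-fresh G {int T} {q′} (t₁ ∷ []) (≤-reflexive (≡-sym int-q′)))
        where
        extend : (∃ λ q₁ → q′ ~ q₁ × int T q₁ ≡ true × q₁ ∉ t₁ ∷ []) → Next-q′
        extend (q₁ , a , i , q₁∉) = q₁ , a , i , (λ e → q₁∉ (here e)) , λ {z} → exhaust-q′ a i q₁∉ {z}

  -- The rim `t`, `q′`, `r′` of `T` takes over the roles of `p`, `q`, `r` one layer deeper: `t` has
  -- one interior neighbour, `q′` and `r′` have two each, and all three see `t₁`.
  climb : ∀ {T p q r t q′ r′} → Ladder T p q r t q′ r′ →
    (∀ S v → (∀ z → S z ≡ true → T z ≡ true) → S v ≡ true → 5 ≤ cut S) →
    ∃ λ t₁ → ∃ λ q₁ → ∃ λ r₁ → Ladder (int T) t q′ r′ t₁ q₁ r₁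
  climb {T} {t = t} L isolated = t₁ , proj₁ nq , proj₁ nr , record
    { p∉T = A.t∉int ; q∉T = A.q′∉int ; r∉T = B.q′∉int
    ; p≢q = q′≢t ∘ ≡-sym ; p≢r = r′≢t ∘ ≡-sym ; q≢r = A.q′≢r′
    ; boundary = λ a i j → A.rim-elim (∧-intro (int-nbr {T} i a) (cong not j))
    ; t∈T = t₁∈int ; q′∈T = proj₁ (proj₂ (proj₂ nq)) ; r′∈T = proj₁ (proj₂ (proj₂ nr))
    ; p~t = t~t₁ ; q~t = A.q′~t₁ t~t₁ t₁∈int ; r~t = B.q′~t₁ t~t₁ t₁∈int
    ; q~q′ = proj₁ (proj₂ nq) ; r~r′ = proj₁ (proj₂ nr)
    ; q′≢t = proj₁ (proj₂ (proj₂ (proj₂ nq))) ; r′≢t = proj₁ (proj₂ (proj₂ (proj₂ nr)))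
    ; from-p = A.from-t t~t₁ t₁∈int
    ; from-q = proj₂ (proj₂ (proj₂ (proj₂ nq))) ; from-r = proj₂ (proj₂ (proj₂ (proj₂ nr)))
    ; deg-q = A.deg-q′ ; deg-r = B.deg-q′ }
    where
    open Ladder L
    module A = Rung L isolated
    module B = Rung (mirror L) isolated
    above = nbr-fresh G {int T} {t} [] (≤-reflexive (≡-sym A.int-t))
    t₁ = proj₁ above
    t~t₁ = proj₁ (proj₂ above)
    t₁∈int = proj₁ (proj₂ (proj₂ above))
    nq = A.next-q′ t~t₁ t₁∈int
    nr = B.next-q′ t~t₁ t₁∈int

  -- Each rung strictly shrinks T, so a finite graph contains no ladder.
  no-ladder : ∀ {T p q r t q′ r′} → Ladder T p q r t q′ r′ →
    ¬ (∀ S v → (∀ z → S z ≡ true → T z ≡ true) → S v ≡ true → 5 ≤ cut S)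
  no-ladder {T} = descend (<-wellFounded (count T))
    where
    descend : ∀ {T p q r t q′ r′} → Acc _<_ (count T) → Ladder T p q r t q′ r′ →
      ¬ (∀ S v → (∀ z → S z ≡ true → T z ≡ true) → S v ≡ true → 5 ≤ cut S)
    descend {T} {t = t} (acc rec) L isolated = descend (rec smaller) (proj₂ (proj₂ (proj₂ (climb L isolated)))) (λ S v i → isolated S v (λ z s → int⊆ {T} (i z s)))
      where
      open Ladder L
      smaller : count (int T) < count T
      smaller = subst (count (int T) <_) (≡-sym (count-− T t t∈T))
        (s≤s (count-mono {f = int T} {T − t} (λ z i → −-intro {S = T} {t} {z} (int⊆ {T} i) (λ { refl → true≢false i (Rung.t∉int L isolated) }))))

-- Minimum cuts

cases : {P : Set} (b : Bool) → (b ≡ true → P) → (b ≡ false → P) → P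
cases true  t f = t refl
cases false t f = f refl

Σ-≥ : (f : Fin m → ℕ) (i : Fin m) → f i ≤ Σℕ f
Σ-≥ f zero    = m≤m+n (f zero) _
Σ-≥ f (suc i) = ≤-trans (Σ-≥ (f ∘ suc) i) (m≤n+m _ (f zero))

Σ-≥₂ : (f : Fin m → ℕ) {i j : Fin m} → i ≢ j → f i + f j ≤ Σℕ f
Σ-≥₂ f {zero}  {zero}  i≢j = ⊥-elim (i≢j refl)
Σ-≥₂ f {zero}  {suc j} i≢j = +-monoʳ-≤ (f zero) (Σ-≥ (f ∘ suc) j)
Σ-≥₂ f {suc i} {zero}  i≢j = ≤-trans (≤-reflexive (+-comm _ (f zero))) (+-monoʳ-≤ (f zero) (Σ-≥ (f ∘ suc) i))
Σ-≥₂ f {suc i} {suc j} i≢j = ≤-trans (Σ-≥₂ (f ∘ suc) (i≢j ∘ cong suc)) (m≤n+m _ (f zero))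

Σ-strict : (f g : Fin m → ℕ) → (∀ i → f i ≤ g i) → ∀ {i} → f i < g i → Σℕ f < Σℕ g
Σ-strict f g f≤g {zero}  lt = +-mono-<-≤ lt (Σ-mono (f≤g ∘ suc))
Σ-strict f g f≤g {suc i} lt = +-mono-≤-< (f≤g zero) (Σ-strict (f ∘ suc) (g ∘ suc) (f≤g ∘ suc) lt)

Σ-≤⇒∃< : (f g : Fin m → ℕ) → Σℕ f ≤ Σℕ g → ∀ {i} → g i < f i → ∃ λ j → f j < g j
Σ-≤⇒∃< f g f≤g lt with any? (λ i → suc (f i) ≤? g i)
... | yes w = w
... | no ¬w = ⊥-elim (<⇒≱ (Σ-strict g f (λ i → ≮⇒≥ (λ l → ¬w (i , l))) lt) f≤g)

-- Divided by `dx * dy`, the hypothesis says p/dx + q/dy ≥ 2. Lowering both denominators to `D`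
-- gives p + q ≥ 2D, and equality leaves neither degree room above `D`.
module WeightedMean {dx dy p q D : ℕ} (mean : 2 * (dx * dy) ≤ dx * q + dy * p)
  (D≤dx : D ≤ dx) (D≤dy : D ≤ dy) (1≤D : 1 ≤ D) where

  private
    eq₁ : ∀ dx dy D → dx * dy * (2 * D) ≡ D * (2 * (dx * dy))
    eq₁ = solve-∀
    eq₂ : ∀ dx dy p q → dy * (dx * q) + dx * (dy * p) ≡ dx * dy * (p + q)
    eq₂ = solve-∀

    scaled : dx * dy * (2 * D) ≤ D * (dx * q) + D * (dy * p)
    scaled = begin
      dx * dy * (2 * D)                 ≡⟨ eq₁ dx dy D ⟩
      D * (2 * (dx * dy))               ≤⟨ *-monoʳ-≤ D mean ⟩
      D * (dx * q + dy * p)             ≡⟨ *-distribˡ-+ D (dx * q) (dy * p) ⟩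
      D * (dx * q) + D * (dy * p)       ∎
      where open ≤-Reasoning

  sum≥ : 2 * D ≤ p + q
  sum≥ = *-cancelˡ-≤ (dx * dy) ⦃ >-nonZero (*-mono-≤ (≤-trans 1≤D D≤dx) (≤-trans 1≤D D≤dy)) ⦄ (begin
    dx * dy * (2 * D)                 ≤⟨ scaled ⟩
    D * (dx * q) + D * (dy * p)       ≤⟨ *-monoˡ-≤ (dx * q) D≤dy ⊕ *-monoˡ-≤ (dy * p) D≤dx ⟩
    dy * (dx * q) + dx * (dy * p)     ≡⟨ eq₂ dx dy p q ⟩
    dx * dy * (p + q)                 ∎)
    where open ≤-Reasoning

  module _ (sum≤ : p + q ≤ 2 * D) (1≤p : 1 ≤ p) (1≤q : 1 ≤ q) where
    private
      total : dy * (dx * q) + dx * (dy * p) ≤ D * (dx * q) + D * (dy * p)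
      total = begin
        dy * (dx * q) + dx * (dy * p)   ≡⟨ eq₂ dx dy p q ⟩
        dx * dy * (p + q)               ≤⟨ *-monoʳ-≤ (dx * dy) sum≤ ⟩
        dx * dy * (2 * D)               ≤⟨ scaled ⟩
        D * (dx * q) + D * (dy * p)     ∎
        where open ≤-Reasoning

      impossible : ∀ {u v d e} → 1 ≤ u → D < d → D ≤ e → d * u + e * v ≤ D * u + D * v → ⊥
      impossible {u} {v} {d} {e} 1≤u D<d D≤e h = infeasible 0
        (*-monoˡ-≤ u D<d ⊕ *-monoˡ-≤ v D≤e ⊕ h ⊕ 1≤u) (eq u v D d e)
        where
        eq : ∀ u v D d e → suc D * u + (D * v + (d * u + e * v + 1)) ≡ suc (d * u + (e * v + (D * u + D * v + u)) + 0)
        eq = solve-∀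

    dy≡D : dy ≡ D
    dy≡D = ≤-antisym (≮⇒≥ (λ D<dy → impossible (*-mono-≤ (≤-trans 1≤D D≤dx) 1≤q) D<dy D≤dx total)) D≤dy

    dx≡D : dx ≡ D
    dx≡D = ≤-antisym (≮⇒≥ (λ D<dx → impossible (*-mono-≤ (≤-trans 1≤D D≤dy) 1≤p) D<dx D≤dy
      (subst₂ _≤_ (+-comm (dy * (dx * q)) _) (+-comm (D * (dx * q)) _) total))) D≤dx

-- Numerical consequences of the curvature bound for a cut edge joining vertices of degrees dx and
-- dy; a and b are the boundary sizes, 1 + α and 1 + β the numbers of cut edges at the two ends.
module EdgeArithmetic {dx dy a′ b′ α β a b sa sb κ : ℕ}
  (curved : dx * b′ + dy * a′ ≤ dx * suc β + dy * suc α)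
  (degʸ : dy ≤ β + b + b′) (degˣ : dx ≤ α + a + a′)
  (sizeˣ : sa + a ≡ κ) (sizeʸ : sb + b ≡ κ)
  (κ<dx : suc κ ≤ dx) (κ<dy : suc κ ≤ dy) where

  private
    mean : 2 * (dx * dy) ≤ dx * suc (2 * β + b) + dy * suc (2 * α + a)
    mean = +-cancelʳ-≤ (dx * b′ + dy * a′) _ _ (begin
      2 * (dx * dy) + (dx * b′ + dy * a′)                                    ≡⟨ eq₁ dx dy a′ b′ ⟩
      (dx * dy + dy * dx) + (dx * b′ + dy * a′)                              ≤⟨ (*-monoʳ-≤ dx degʸ ⊕ *-monoʳ-≤ dy degˣ) ⊕ curved ⟩
      (dx * (β + b + b′) + dy * (α + a + a′)) + (dx * suc β + dy * suc α)    ≡⟨ eq₂ dx dy a′ b′ α β a b ⟩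
      dx * suc (2 * β + b) + dy * suc (2 * α + a) + (dx * b′ + dy * a′)      ∎)
      where
      open ≤-Reasoning
      eq₁ : ∀ dx dy a′ b′ → 2 * (dx * dy) + (dx * b′ + dy * a′) ≡ (dx * dy + dy * dx) + (dx * b′ + dy * a′)
      eq₁ = solve-∀
      eq₂ : ∀ dx dy a′ b′ α β a b → (dx * (β + b + b′) + dy * (α + a + a′)) + (dx * suc β + dy * suc α) ≡
        dx * suc (2 * β + b) + dy * suc (2 * α + a) + (dx * b′ + dy * a′)
      eq₂ = solve-∀

    module Mean = WeightedMean mean κ<dx κ<dy (s≤s z≤n)

  -- Any cut edge carries at least half of the total excess at its ends: the weighted mean yields
  -- 2(κ + 1) ≤ (2α + a + 1) + (2β + b + 1), where a = κ - sa and b = κ - sb.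
  excess : sa + sb ≤ 2 * α + 2 * β
  excess = ≮⇒≥ (λ gap → infeasible 0 (gap ⊕ Mean.sum≥ ⊕ ≤-reflexive sizeˣ ⊕ ≤-reflexive sizeʸ) (eq α β a b sa sb κ))
    where
    eq : ∀ α β a b sa sb κ → suc (2 * α + 2 * β) + (2 * suc κ + (sa + a + (sb + b))) ≡
      suc (sa + sb + (suc (2 * α + a) + suc (2 * β + b) + (κ + κ)) + 0)
    eq = solve-∀

  module Tight (tight : 2 * α + 2 * β ≤ sa + sb) where
    private
      sum≤ : suc (2 * α + a) + suc (2 * β + b) ≤ 2 * suc κ
      sum≤ = ≮⇒≥ (λ gap → infeasible 0
        (gap ⊕ tight ⊕ ≤-reflexive sizeˣ ⊕ ≤-reflexive sizeʸ) (eq α β a b sa sb κ))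
        where
        eq : ∀ α β a b sa sb κ → suc (2 * suc κ) + (2 * α + 2 * β + (sa + a + (sb + b))) ≡
          suc (suc (2 * α + a) + suc (2 * β + b) + (sa + sb + (κ + κ)) + 0)
        eq = solve-∀

    degreeʸ : dy ≡ suc κ
    degreeʸ = Mean.dy≡D sum≤ (s≤s z≤n) (s≤s z≤n)

    degreeˣ : dx ≡ suc κ
    degreeˣ = Mean.dx≡D sum≤ (s≤s z≤n) (s≤s z≤n)

    -- With equal degrees the curvature bound becomes a′ + b′ ≤ α + β + 2. Then the right-hand sides
    -- of the two degree bounds add up to at most 2(κ + 1), so neither bound has slack.
    innerʸ : β + b + b′ ≡ suc κ
    innerʸ = ≤-antisym upper (subst (_≤ β + b + b′) degreeʸ degʸ)
      where
      flat : b′ + a′ ≤ suc β + suc α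
      flat = *-cancelˡ-≤ (suc κ) (subst₂ _≤_ (≡-sym (*-distribˡ-+ (suc κ) b′ a′)) (≡-sym (*-distribˡ-+ (suc κ) (suc β) (suc α)))
        (subst₂ (λ u v → u * b′ + v * a′ ≤ u * suc β + v * suc α) degreeˣ degreeʸ curved))
      upper : β + b + b′ ≤ suc κ
      upper = ≮⇒≥ (λ gap → infeasible 0 (flat ⊕ sum≤ ⊕ gap ⊕ subst (_≤ α + a + a′) degreeˣ degˣ) (eq a′ b′ α β a b κ))
        where
        eq : ∀ a′ b′ α β a b κ → b′ + a′ + (suc (2 * α + a) + suc (2 * β + b) + (suc (suc κ) + suc κ)) ≡
          suc (suc β + suc α + (2 * suc κ + (β + b + b′ + (α + a + a′))) + 0)
        eq = solve-∀

-- Boundary, interior and excess on the two sides of a cut below the minimum degree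

module MinCut {m : ℕ} (G : SimpleGraph m) (curvature-cut : CurvatureBound G)
              (κ : ℕ) (κ<deg : ∀ v → κ < deg G v) where
  open Neighbourhoods G

  infix 4 _~_
  _~_ : Fin m → Fin m → Set
  u ~ v = adj G u v ≡ true

  module Side (X Y : Pred m) (X≡∁Y : ∀ i → X i ≡ not (Y i)) (size : edges Y X ≡ κ) where

    ∉Y : ∀ {i} → X i ≡ true → Y i ≡ false
    ∉Y {i} p = not-true (trans (≡-sym (X≡∁Y i)) p)

    ∈X : ∀ {i} → Y i ≡ false → X i ≡ true
    ∈X {i} p = trans (X≡∁Y i) (cong not p)

    out : Fin m → ℕ
    out = nbr X

    inn : Fin m → ℕ
    inn = nbr (int Y)

    rim : Pred m
    rim y = Y y ∧ not (int Y y)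

    rim⊆Y : ∀ {y} → rim y ≡ true → Y y ≡ true
    rim⊆Y = ∧-fst

    rim∉int : ∀ {y} → rim y ≡ true → int Y y ≡ false
    rim∉int {y} e = not-true (∧-snd {Y y} e)

    rim-intro : ∀ {y x} → Y y ≡ true → y ~ x → X x ≡ true → rim y ≡ true
    rim-intro {y} {x} y∈Y a x∈X = ∧-intro y∈Y (cong not (¬-not (λ i → true≢false (int-nbr {Y} {y} {x} i a) (∉Y x∈X))))

    rim-elim : ∀ {y} → rim y ≡ true → ∃ λ x → y ~ x × X x ≡ true
    rim-elim {y} e = let x , a , x∉Y = ¬int {Y} {y} (rim⊆Y e) (rim∉int e) in x , a , ∈X x∉Y

    -- The factor `⟦ rim y ⟧` discards the vertices of `X`, whose `out` does not count cut edges.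
    β : Fin m → ℕ
    β y = ⟦ rim y ⟧ * (out y ∸ 1)

    Sβ : ℕ
    Sβ = Σℕ β

    out≡ : ∀ {y} → rim y ≡ true → out y ≡ suc (β y)
    out≡ {y} e = ≡-sym (trans (cong (λ b → suc (⟦ b ⟧ * (out y ∸ 1))) e) (trans (cong suc (*-identityˡ _)) (m+[n∸m]≡n 1≤out)))
      where
      1≤out : 1 ≤ out y
      1≤out = let x , a , x∈X = rim-elim e in length≤nbr G {X} {y} (x ∷ []) ([] ∷ []) ((a , x∈X) ∷ [])

    edges-rim : ∀ u → ⟦ Y u ⟧ * out u ≡ β u + ⟦ rim u ⟧
    edges-rim u = cases (rim u)
      (λ e → trans (cong (λ b → ⟦ b ⟧ * out u) (rim⊆Y e)) (trans (*-identityˡ (out u))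
        (trans (out≡ e) (trans (+-comm 1 (β u)) (cong (λ b → β u + ⟦ b ⟧) (≡-sym e))))))
      (λ e → trans (off e) (≡-sym (cong (λ b → ⟦ b ⟧ * (out u ∸ 1) + ⟦ b ⟧) e)))
      where
      off : rim u ≡ false → ⟦ Y u ⟧ * out u ≡ 0
      off e = cases (Y u)
        (λ y → trans (cong (⟦ Y u ⟧ *_) (nbr-none X u (λ z a x → true≢false (rim-intro y a x) e))) (*-zeroʳ ⟦ Y u ⟧))
        (λ y → cong (λ b → ⟦ b ⟧ * out u) y)

    size-rim : Sβ + count rim ≡ κ
    size-rim = begin
      Sβ + count rim                       ≡⟨ cong (Sβ +_) (count≡Σ rim) ⟩
      Sβ + Σℕ (λ u → ⟦ rim u ⟧)            ≡⟨ Σ-+ β (λ u → ⟦ rim u ⟧) ⟨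
      Σℕ (λ u → β u + ⟦ rim u ⟧)           ≡⟨ Σ-cong (λ u → ≡-sym (edges-rim u)) ⟩
      edges Y X                            ≡⟨ size ⟩
      κ                                    ∎
      where open ≡-Reasoning

    nbr-Y : ∀ y → nbr Y y + out y ≡ deg G y
    nbr-Y y = trans (cong (nbr Y y +_) (nbr-cong y X≡∁Y)) (nbr-∁ Y y)

    nbr-rim : ∀ y → nbr Y y ≡ inn y + nbr rim y
    nbr-rim y = trans (nbr-split Y (int Y) y) (cong (_+ nbr rim y)
      (nbr-cong y (λ z → ⇔→≡ (∧-snd {Y z}) (λ i → ∧-intro (int⊆ {Y} i) i))))

    rim-degree : ∀ {y} → rim y ≡ true → suc (nbr rim y) ≤ count rim
    rim-degree {y} e = subst (suc (nbr rim y) ≤_) (≡-sym (count-− rim y e))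
      (s≤s (count-mono {f = λ z → adj G y z ∧ rim z} {rim − y}
        (λ z p → −-intro {S = rim} {y} {z} (∧-snd {adj G y z} p) (adj⇒≢ G (∧-fst p)))))

    degree≤ : ∀ {y} → rim y ≡ true → deg G y ≤ β y + count rim + inn y
    degree≤ {y} e = begin
      deg G y                              ≡⟨ nbr-Y y ⟨
      nbr Y y + out y                      ≡⟨ cong₂ _+_ (nbr-rim y) (out≡ e) ⟩
      inn y + nbr rim y + suc (β y)        ≡⟨ eq (inn y) (nbr rim y) (β y) ⟩
      β y + suc (nbr rim y) + inn y        ≤⟨ +-monoˡ-≤ (inn y) (+-monoʳ-≤ (β y) (rim-degree e)) ⟩
      β y + count rim + inn y              ∎
      where
      open ≤-Reasoning
      eq : ∀ i r b → i + r + suc b ≡ b + suc r + i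
      eq = solve-∀

    -- All neighbours of an interior vertex lie in `Y`, so an edge leaving the interior ends on the
    -- rim.
    cut-int : cut (int Y) ≡ Σℕ (λ u → ⟦ rim u ⟧ * inn u)
    cut-int = trans (edges-sym (int Y) (∁ (int Y))) (Σ-cong pointwise)
      where
      pointwise : ∀ u → ⟦ ∁ (int Y) u ⟧ * inn u ≡ ⟦ rim u ⟧ * inn u
      pointwise u = cases (Y u)
        (λ y → cong (λ b → ⟦ b ∧ not (int Y u) ⟧ * inn u) (≡-sym y))
        (λ y → trans (cong (⟦ ∁ (int Y) u ⟧ *_) (none y)) (trans (*-zeroʳ ⟦ ∁ (int Y) u ⟧)
          (≡-sym (trans (cong (⟦ rim u ⟧ *_) (none y)) (*-zeroʳ ⟦ rim u ⟧)))))
        where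
        none : Y u ≡ false → inn u ≡ 0
        none y = nbr-none (int Y) u (λ z a i → true≢false (int-nbr {Y} {z} {u} i (adj-sym a)) y)

    out<inn : ∀ {y} → ⟦ Y y ⟧ * out y < ⟦ rim y ⟧ * inn y → rim y ≡ true × out y < inn y
    out<inn {y} lt = cases (rim y)
      (λ e → e , subst₂ _<_ (trans (cong (λ b → ⟦ b ⟧ * out y) (rim⊆Y e)) (*-identityˡ (out y)))
                            (trans (cong (λ b → ⟦ b ⟧ * inn y) e) (*-identityˡ (inn y))) lt)
      (λ e → ⊥-elim (n≮0 (subst (λ b → ⟦ Y y ⟧ * out y < ⟦ b ⟧ * inn y) e lt)))

    inn<out : ∀ {y} → rim y ≡ true → inn y < out y → ⟦ rim y ⟧ * inn y < ⟦ Y y ⟧ * out y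
    inn<out {y} e = subst₂ _<_ (≡-sym (trans (cong (λ b → ⟦ b ⟧ * inn y) e) (*-identityˡ (inn y))))
      (≡-sym (trans (cong (λ b → ⟦ b ⟧ * out y) (rim⊆Y e)) (*-identityˡ (out y))))

    -- At most `β y + count rim` ≤ κ edges at `y` avoid the interior, and the degree is larger.
    inhabited : ∀ {y} → rim y ≡ true → ∃ λ z → int Y z ≡ true
    inhabited {y} e = let z , _ , i , _ = nbr-fresh G {int Y} {y} [] 1≤inn in z , i
      where
      1≤inn : 1 ≤ inn y
      1≤inn = ≮⇒≥ (λ inn<1 → infeasible 0
        (κ<deg y ⊕ degree≤ e ⊕ Σ-≥ β y ⊕ ≤-reflexive size-rim ⊕ inn<1)
        (eq κ (deg G y) (β y) (count rim) (inn y) Sβ))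
        where
        eq : ∀ κ d b c i s → suc κ + (d + (b + (s + c + suc i))) ≡ suc (d + (b + c + i + (s + (κ + 1))) + 0)
        eq = solve-∀

    -- Since `inn y` ≤ `β y`, the degree bound gives κ < 2 `β y` + `count rim`; subtracting the size
    -- of the rim leaves `Sβ` on the left.
    excess-rim : ∀ {y} → rim y ≡ true → inn y < out y → suc Sβ ≤ 2 * β y
    excess-rim {y} e inn<out = ≮⇒≥ (λ gap → infeasible 0
      (κ<deg y ⊕ degree≤ e ⊕ subst (suc (inn y) ≤_) (out≡ e) inn<out ⊕ ≤-reflexive size-rim ⊕ gap)
      (eq κ (deg G y) (β y) (count rim) (inn y) Sβ))
      where
      eq : ∀ κ d b c i s → suc κ + (d + (suc i + (s + c + suc (2 * b)))) ≡ suc (d + (b + c + i + (suc b + (κ + suc s))) + 0)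
      eq = solve-∀

  -- A double complement agrees with the original only pointwise. Asking for both equations makes
  -- the hypotheses symmetric, so exchanging `X` and `Y` is just another instance.
  module Pair (X Y : Pred m) (X≡∁Y : ∀ i → X i ≡ not (Y i)) (Y≡∁X : ∀ i → Y i ≡ not (X i))
              (sizeʸ : edges Y X ≡ κ) (sizeˣ : edges X Y ≡ κ) where
    module 𝕐 = Side X Y X≡∁Y sizeʸ
    module 𝕏 = Side Y X Y≡∁X sizeˣ

    -- The curvature bound made symmetric: interior vertices of `X` lie outside `cl Y`, so the
    -- neighbours of `x` in `cl Y` number at most its degree minus `𝕏.inn x`.
    curved : ∀ {x y} → X x ≡ true → Y y ≡ true → x ~ y →
      deg G x * 𝕐.inn y + deg G y * 𝕏.inn x ≤ deg G x * 𝕐.out y + deg G y * 𝕏.out x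
    curved {x} {y} x∈X y∈Y a = +-cancelʳ-≤ (dx * nbr Y y) _ _ (begin
      dx * 𝕐.inn y + dy * 𝕏.inn x + dx * nbr Y y          ≡⟨ eq₁ dx dy (𝕐.inn y) (𝕏.inn x) (nbr Y y) ⟩
      dx * (nbr Y y + 𝕐.inn y) + dy * 𝕏.inn x             ≤⟨ +-monoˡ-≤ (dy * 𝕏.inn x) (curvature-cut Y a (𝕐.∉Y x∈X) y∈Y) ⟩
      dy * (nbr (cl Y) x + nbr Y x) + dy * 𝕏.inn x        ≡⟨ eq₂ dy (nbr (cl Y) x) (nbr Y x) (𝕏.inn x) ⟩
      dy * (nbr (cl Y) x + 𝕏.inn x) + dy * nbr Y x        ≤⟨ +-monoˡ-≤ (dy * nbr Y x) (*-monoʳ-≤ dy split) ⟩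
      dy * dx + dy * nbr Y x                              ≡⟨ cong (λ t → t * dx + dy * nbr Y x) (≡-sym (𝕐.nbr-Y y)) ⟩
      (nbr Y y + 𝕐.out y) * dx + dy * nbr Y x             ≡⟨ eq₃ dx dy (𝕐.out y) (nbr Y x) (nbr Y y) ⟩
      dx * 𝕐.out y + dy * 𝕏.out x + dx * nbr Y y          ∎)
      where
      open ≤-Reasoning
      dx = deg G x
      dy = deg G y
      eq₁ : ∀ dx dy b a n → dx * b + dy * a + dx * n ≡ dx * (n + b) + dy * a
      eq₁ = solve-∀
      eq₂ : ∀ dy c n a → dy * (c + n) + dy * a ≡ dy * (c + a) + dy * n
      eq₂ = solve-∀
      eq₃ : ∀ dx dy o n k → (k + o) * dx + dy * n ≡ dx * o + dy * n + dx * k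
      eq₃ = solve-∀
      split : nbr (cl Y) x + 𝕏.inn x ≤ dx
      split = ≤-trans (+-monoʳ-≤ (nbr (cl Y) x) (nbr-mono {int X} {∁ (cl Y)} x outside)) (≤-reflexive (nbr-∁ (cl Y) x))
        where
        outside : ∀ z → x ~ z → int X z ≡ true → ∁ (cl Y) z ≡ true
        outside z _ i = cong not (¬-not (λ c → refute (cl-elim {Y} {z} c)))
          where
          refute : ¬ (Y z ≡ true ⊎ (∃ λ w → z ~ w × Y w ≡ true))
          refute (inj₁ z∈Y) = true≢false z∈Y (𝕐.∉Y (int⊆ {X} i))
          refute (inj₂ (w , b , w∈Y)) = true≢false w∈Y (𝕐.∉Y (int-nbr {X} {z} {w} i b))

    flip : ∀ {x y} → X x ≡ true → Y y ≡ true → x ~ y → 𝕐.out y < 𝕐.inn y → 𝕏.inn x < 𝕏.out x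
    flip {x} {y} x∈X y∈Y a out<inn = ≰⇒> (λ out≤inn → infeasible 0
      (curved x∈X y∈Y a ⊕ *-monoʳ-≤ (deg G x) out<inn ⊕ *-monoʳ-≤ (deg G y) out≤inn ⊕ ≤-trans (s≤s z≤n) (κ<deg x))
      (eq (deg G x) (deg G y) (𝕐.inn y) (𝕏.inn x) (𝕐.out y) (𝕏.out x)))
      where
      eq : ∀ dx dy b′ a′ b a → dx * b′ + dy * a′ + (dx * suc b + (dy * a + 1)) ≡
        suc (dx * b + dy * a + (dx * b′ + (dy * a′ + dx)) + 0)
      eq = solve-∀

    unique-excess : ∀ {x x′} → 𝕏.rim x ≡ true → 𝕏.rim x′ ≡ true → 𝕏.inn x < 𝕏.out x → 𝕏.inn x′ < 𝕏.out x′ → x ≡ x′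
    unique-excess {x} {x′} e e′ h h′ with x ≟ x′
    ... | yes p = p
    ... | no x≢x′ = ⊥-elim (infeasible 1
      (𝕏.excess-rim e h ⊕ 𝕏.excess-rim e′ h′ ⊕ 2 ⊗ Σ-≥₂ 𝕏.β x≢x′) (eq 𝕏.Sβ (𝕏.β x) (𝕏.β x′)))
      where
      eq : ∀ s a b → suc s + (suc s + 2 * (a + b)) ≡ suc (2 * a + (2 * b + 2 * s) + 1)
      eq = solve-∀

    -- By `flip` every neighbour of `y` across the cut has fewer inner neighbours than cut edges,
    -- and by `unique-excess` only one vertex does.
    single : ∀ {x y} → X x ≡ true → Y y ≡ true → x ~ y → 𝕐.out y < 𝕐.inn y → 𝕐.β y ≡ 0
    single {x} {y} x∈X y∈Y a out<inn = n≤0⇒n≡0 (+-cancelˡ-≤ 1 _ _ (subst (_≤ 1) (𝕐.out≡ (𝕐.rim-intro y∈Y (adj-sym a) x∈X))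
      (nbr≤length G {X} {y} (x ∷ []) (λ z b z∈X → here (≡-sym (unique-excess
        (𝕏.rim-intro x∈X a y∈Y) (𝕏.rim-intro z∈X (adj-sym b) y∈Y)
        (flip x∈X y∈Y a out<inn) (flip z∈X y∈Y (adj-sym b) out<inn)))))))

    module Edge {x y} (x∈X : X x ≡ true) (y∈Y : Y y ≡ true) (x~y : x ~ y) where
      rimˣ = 𝕏.rim-intro x∈X x~y y∈Y
      rimʸ = 𝕐.rim-intro y∈Y (adj-sym x~y) x∈X
      open EdgeArithmetic {deg G x} {deg G y} {𝕏.inn x} {𝕐.inn y} {𝕏.β x} {𝕐.β y}
        {count 𝕏.rim} {count 𝕐.rim} {𝕏.Sβ} {𝕐.Sβ} {κ}
        (subst₂ (λ s t → deg G x * 𝕐.inn y + deg G y * 𝕏.inn x ≤ deg G x * s + deg G y * t)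
          (𝕐.out≡ rimʸ) (𝕏.out≡ rimˣ) (curved x∈X y∈Y x~y))
        (𝕐.degree≤ rimʸ) (𝕏.degree≤ rimˣ) 𝕏.size-rim 𝕐.size-rim (κ<deg x) (κ<deg y) public

-- The double star of an extremal cut

module Extremal {m : ℕ} (G : SimpleGraph m) (curvature-cut : CurvatureBound G) (Y : Pred m)
                (κ<deg : ∀ v → Neighbourhoods.cut G Y < deg G v) where
  open Neighbourhoods G
  open MinCut G curvature-cut (cut Y) κ<deg
  private
    κ = cut Y
    X = ∁ Y

  module Forth = Pair X Y (λ _ → refl) (λ i → ≡-sym (Bool.not-involutive (Y i))) refl (edges-sym X Y)
  module Back = Pair Y X (λ i → ≡-sym (Bool.not-involutive (Y i))) (λ _ → refl) (edges-sym X Y) refl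
  open Forth using (module 𝕏; module 𝕐)

  Minimal : Set
  Minimal = ∀ S u v → S u ≡ true → S v ≡ false → κ ≤ cut S

  StrictlyMinimal : Set
  StrictlyMinimal = ∀ S → (∀ z → S z ≡ true → Y z ≡ true) →
    ∀ v w → S v ≡ true → Y w ≡ true → S w ≡ false → κ < cut S

  -- Each of x₀ and y₀ carries more than half of the excess Sβ of its side (the number of cut edges
  -- minus the number of boundary vertices), and the cut edges turn out to form a double star with
  -- centres x₀ and y₀.
  module DoubleStar (strict : StrictlyMinimal) {x₀ x₁ y₀ y₁ : Fin m}
    (x₀∈X : X x₀ ≡ true) (y₁∈Y : Y y₁ ≡ true) (x₀~y₁ : x₀ ~ y₁) (y₁-surplus : 𝕐.out y₁ < 𝕐.inn y₁)
    (x₁∈X : X x₁ ≡ true) (y₀∈Y : Y y₀ ≡ true) (x₁~y₀ : x₁ ~ y₀) (x₁-surplus : 𝕏.out x₁ < 𝕏.inn x₁) where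

    s = 𝕏.Sβ
    k = count 𝕐.rim

    rim-x₀ : 𝕏.rim x₀ ≡ true
    rim-x₀ = 𝕏.rim-intro x₀∈X x₀~y₁ y₁∈Y

    rim-y₀ : 𝕐.rim y₀ ≡ true
    rim-y₀ = 𝕐.rim-intro y₀∈Y (adj-sym x₁~y₀) x₁∈X

    β-y₁ : 𝕐.β y₁ ≡ 0
    β-y₁ = Forth.single x₀∈X y₁∈Y x₀~y₁ y₁-surplus

    α-x₁ : 𝕏.β x₁ ≡ 0
    α-x₁ = Back.single y₀∈Y x₁∈X (adj-sym x₁~y₀) x₁-surplus

    excess₁ : s + 𝕐.Sβ ≤ 2 * 0 + 2 * 𝕐.β y₀
    excess₁ = subst (λ t → s + 𝕐.Sβ ≤ 2 * t + 2 * 𝕐.β y₀) α-x₁ (Forth.Edge.excess x₁∈X y₀∈Y x₁~y₀)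

    excess₀ : s + 𝕐.Sβ ≤ 2 * 𝕏.β x₀ + 2 * 0
    excess₀ = subst (λ t → s + 𝕐.Sβ ≤ 2 * 𝕏.β x₀ + 2 * t) β-y₁ (Forth.Edge.excess x₀∈X y₁∈Y x₀~y₁)

    -- Twice the excess at `x₀`, hence twice that of `X`, is at least the total; the same holds for
    -- `y₀` and `Y`.
    balanced : 𝕐.Sβ ≡ s
    balanced = ≤-antisym
      (≮⇒≥ (λ gap → infeasible 0 (excess₀ ⊕ 2 ⊗ Σ-≥ 𝕏.β x₀ ⊕ gap) (eq₀ s 𝕐.Sβ (𝕏.β x₀))))
      (≮⇒≥ (λ gap → infeasible 0 (excess₁ ⊕ 2 ⊗ Σ-≥ 𝕐.β y₀ ⊕ gap) (eq₁ s 𝕐.Sβ (𝕐.β y₀))))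
      where
      eq₀ : ∀ s s′ a → s + s′ + (2 * a + suc s) ≡ suc (2 * a + 2 * 0 + (2 * s + s′) + 0)
      eq₀ = solve-∀
      eq₁ : ∀ s s′ b → s + s′ + (2 * b + suc s′) ≡ suc (2 * 0 + 2 * b + (2 * s′ + s) + 0)
      eq₁ = solve-∀

    half : ∀ {t} → s + 𝕐.Sβ ≤ 2 * t → s ≤ t
    half {t} h = *-cancelˡ-≤ 2 (subst (_≤ 2 * t) (trans (cong (s +_) balanced) (eq s)) h)
      where
      eq : ∀ s → s + s ≡ 2 * s
      eq = solve-∀

    α-x₀ : 𝕏.β x₀ ≡ s
    α-x₀ = ≤-antisym (Σ-≥ 𝕏.β x₀) (half (≤-trans excess₀ (≤-reflexive (+-identityʳ (2 * 𝕏.β x₀)))))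

    β-y₀ : 𝕐.β y₀ ≡ s
    β-y₀ = ≤-antisym (≤-trans (Σ-≥ 𝕐.β y₀) (≤-reflexive balanced)) (half excess₁)

    1≤s : 1 ≤ s
    1≤s = +-cancelˡ-≤ s 1 s (subst₂ _≤_ (+-comm 1 s) (trans (cong (2 *_) α-x₀) (eq s))
      (𝕏.excess-rim rim-x₀ (Forth.flip x₀∈X y₁∈Y x₀~y₁ y₁-surplus)))
      where
      eq : ∀ s → 2 * s ≡ s + s
      eq = solve-∀

    α-rest : ∀ {x} → x ≢ x₀ → 𝕏.β x ≡ 0
    α-rest {x} x≢x₀ = n≤0⇒n≡0 (+-cancelʳ-≤ s _ 0 (subst (λ t → 𝕏.β x + t ≤ s) α-x₀ (Σ-≥₂ 𝕏.β x≢x₀)))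

    β-rest : ∀ {y} → y ≢ y₀ → 𝕐.β y ≡ 0
    β-rest {y} y≢y₀ = n≤0⇒n≡0 (+-cancelʳ-≤ s _ 0 (subst₂ (λ t u → 𝕐.β y + t ≤ u) β-y₀ balanced (Σ-≥₂ 𝕐.β y≢y₀)))

    -- The centres hold all the excess, and the ends of a cut edge must hold half of a positive
    -- total.
    star : ∀ {x y} → X x ≡ true → Y y ≡ true → x ~ y → x ≡ x₀ ⊎ y ≡ y₀
    star {x} {y} x∈X y∈Y x~y = decide (x ≟ x₀) (y ≟ y₀)
      where
      decide : Dec (x ≡ x₀) → Dec (y ≡ y₀) → x ≡ x₀ ⊎ y ≡ y₀
      decide (yes e) _       = inj₁ e
      decide (no _)  (yes e) = inj₂ e
      decide (no x≢) (no y≢) = ⊥-elim (<⇒≱ 1≤s (≤-trans (m≤m+n s 𝕐.Sβ)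
        (subst₂ (λ t u → s + 𝕐.Sβ ≤ 2 * t + 2 * u) (α-rest x≢) (β-rest y≢) (Forth.Edge.excess x∈X y∈Y x~y))))

    y₁≢y₀ : y₁ ≢ y₀
    y₁≢y₀ refl = <⇒≱ 1≤s (≤-reflexive (trans (≡-sym β-y₀) β-y₁))

    tight₁ : 2 * 𝕏.β x₁ + 2 * 𝕐.β y₀ ≤ s + 𝕐.Sβ
    tight₁ = ≤-reflexive (trans (cong₂ (λ t u → 2 * t + 2 * u) α-x₁ β-y₀) (trans (eq s) (cong (s +_) (≡-sym balanced))))
      where
      eq : ∀ s → 2 * 0 + 2 * s ≡ s + s
      eq = solve-∀

    tight₀ : ∀ {y} → y ≢ y₀ → 2 * 𝕏.β x₀ + 2 * 𝕐.β y ≤ s + 𝕐.Sβ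
    tight₀ y≢y₀ = ≤-reflexive (trans (cong₂ (λ t u → 2 * t + 2 * u) α-x₀ (β-rest y≢y₀)) (trans (eq s) (cong (s +_) (≡-sym balanced))))
      where
      eq : ∀ s → 2 * s + 2 * 0 ≡ s + s
      eq = solve-∀

    deg-y₀ : deg G y₀ ≡ suc κ
    deg-y₀ = Forth.Edge.Tight.degreeʸ x₁∈X y₀∈Y x₁~y₀ tight₁

    deg-x₀ : deg G x₀ ≡ suc κ
    deg-x₀ = Forth.Edge.Tight.degreeˣ x₀∈X y₁∈Y x₀~y₁ (tight₀ y₁≢y₀)

    κ≡s+k : s + k ≡ κ
    κ≡s+k = subst (λ t → t + k ≡ κ) balanced 𝕐.size-rim

    out-y₀ : 𝕐.out y₀ ≡ suc s
    out-y₀ = trans (𝕐.out≡ rim-y₀) (cong suc β-y₀)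

    inn-y₀ : 𝕐.inn y₀ ≡ 1
    inn-y₀ = +-cancelˡ-≡ (s + k) _ _ (trans (cong (λ t → t + k + 𝕐.inn y₀) (≡-sym β-y₀))
      (trans (Forth.Edge.Tight.innerʸ x₁∈X y₀∈Y x₁~y₀ tight₁) (trans (cong suc (≡-sym κ≡s+k)) (+-comm 1 (s + k)))))

    -- Equal excess means that `X` has `k` boundary vertices as well. Those other than `x₀` must be
    -- attached to `y₀`, which has only s + 1 cut edges.
    k≤ : k ≤ suc (suc s)
    k≤ = begin
      k                            ≡⟨ +-cancelˡ-≡ s _ _ (trans κ≡s+k (≡-sym 𝕏.size-rim)) ⟩
      count 𝕏.rim                  ≡⟨ count-− 𝕏.rim x₀ rim-x₀ ⟩
      suc (count (𝕏.rim − x₀))     ≤⟨ s≤s (count-mono {f = 𝕏.rim − x₀} {λ z → adj G y₀ z ∧ X z} leaf) ⟩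
      suc (𝕐.out y₀)               ≡⟨ cong suc out-y₀ ⟩
      suc (suc s)                  ∎
      where
      open ≤-Reasoning
      leaf : ∀ z → (𝕏.rim − x₀) z ≡ true → adj G y₀ z ∧ X z ≡ true
      leaf z p = attach (−-elim {S = 𝕏.rim} {x₀} {z} p)
        where
        attach : 𝕏.rim z ≡ true × x₀ ≢ z → adj G y₀ z ∧ X z ≡ true
        attach (e , x₀≢z) = let y , z~y , y∈Y = 𝕏.rim-elim e in
          ∧-intro (centre z~y (star (𝕏.rim⊆Y e) y∈Y z~y)) (𝕏.rim⊆Y e)
          where
          centre : ∀ {y} → z ~ y → z ≡ x₀ ⊎ y ≡ y₀ → y₀ ~ z
          centre z~y (inj₁ refl) = ⊥-elim (x₀≢z refl)
          centre z~y (inj₂ refl) = adj-sym z~y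

    -- For the lower bound on `k`: removing `y₀` from `Y` changes the cut by deg `y₀` - 2 `out y₀` =
    -- κ + 1 - 2(s + 1), which strict minimality makes positive.
    κ-value : κ ≡ suc s + suc s
    κ-value = trans (≡-sym κ≡s+k) (trans (cong (s +_) (≤-antisym k≤ k≥)) (eq s))
      where
      eq : ∀ s → s + suc (suc s) ≡ suc s + suc s
      eq = solve-∀
      smaller : suc κ ≤ cut (Y − y₀)
      smaller = strict (Y − y₀) (λ z p → proj₁ (−-elim {S = Y} {y₀} {z} p)) y₁ y₀
        (−-intro {S = Y} {y₀} {y₁} y₁∈Y (y₁≢y₀ ∘ ≡-sym)) y₀∈Y (¬-not (λ p → proj₂ (−-elim {S = Y} {y₀} {y₀} p) refl))
      k≥ : suc (suc s) ≤ k
      k≥ = ≮⇒≥ (λ gap → infeasible 0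
        (smaller ⊕ ≤-reflexive (cut-− Y y₀ y₀∈Y) ⊕ ≤-reflexive (𝕐.nbr-Y y₀) ⊕ ≤-reflexive deg-y₀
          ⊕ 2 ⊗ ≤-reflexive (≡-sym out-y₀) ⊕ ≤-reflexive (≡-sym κ≡s+k) ⊕ gap)
        (eq′ κ (cut (Y − y₀)) (nbr X y₀) (nbr Y y₀) (deg G y₀) s k))
        where
        eq′ : ∀ κ c o n d s k → suc κ + (c + o + (n + o + (d + (2 * suc s + (κ + suc k))))) ≡
          suc (c + (κ + n + (d + (suc κ + (2 * o + (s + k + suc (suc s)))))) + 0)
        eq′ = solve-∀

    module Leaf {y} (e : 𝕐.rim y ≡ true) (y≢y₀ : y ≢ y₀) where

      from-y : ∀ {x} → y ~ x → X x ≡ true → x ≡ x₀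
      from-y a x∈X = centre (star x∈X (𝕐.rim⊆Y e) (adj-sym a))
        where
        centre : ∀ {x} → x ≡ x₀ ⊎ y ≡ y₀ → x ≡ x₀
        centre (inj₁ p) = p
        centre (inj₂ p) = ⊥-elim (y≢y₀ p)

      x₀~y : x₀ ~ y
      x₀~y = let x , a , x∈X = 𝕐.rim-elim e in adj-sym (subst (y ~_) (from-y a x∈X) a)

      deg-y : deg G y ≡ suc κ
      deg-y = Forth.Edge.Tight.degreeʸ x₀∈X (𝕐.rim⊆Y e) x₀~y (tight₀ y≢y₀)

      inn-y : 𝕐.inn y ≡ suc s
      inn-y = +-cancelˡ-≡ k _ _ (trans (cong (λ t → t + k + 𝕐.inn y) (≡-sym (β-rest y≢y₀)))
        (trans (Forth.Edge.Tight.innerʸ x₀∈X (𝕐.rim⊆Y e) x₀~y (tight₀ y≢y₀))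
          (trans (cong suc (≡-sym κ≡s+k)) (eq s k))))
        where
        eq : ∀ s k → suc (s + k) ≡ k + suc s
        eq = solve-∀

      private
        Y₁ = Y − y₀

      y∈Y₁ : Y₁ y ≡ true
      y∈Y₁ = −-intro {S = Y} {y₀} {y} (𝕐.rim⊆Y e) (y≢y₀ ∘ ≡-sym)

      x₀∉Y₁ : Y₁ x₀ ≡ false
      x₀∉Y₁ = ¬-not (λ p → true≢false (proj₁ (−-elim {S = Y} {y₀} {x₀} p)) (𝕐.∉Y x₀∈X))

      nbr-x₀ : nbr Y x₀ ≡ suc s
      nbr-x₀ = trans (𝕏.out≡ rim-x₀) (cong suc α-x₀)

      -- A vertex outside `Y` with a neighbour in `Y − y₀` is `x₀` itself, so the closure adds to
      -- `x₀` no neighbours outside `Y`.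
      closure : nbr (cl Y₁) x₀ ≤ suc s
      closure = ≤-trans (nbr-mono {cl Y₁} {Y} x₀ inside) (≤-reflexive nbr-x₀)
        where
        inside : ∀ z → x₀ ~ z → cl Y₁ z ≡ true → Y z ≡ true
        inside z a c = cases (Y z) (λ z∈Y → z∈Y) (λ z∉Y → ⊥-elim (refute z∉Y (cl-elim {Y₁} {z} c)))
          where
          refute : Y z ≡ false → ¬ (Y₁ z ≡ true ⊎ (∃ λ w → z ~ w × Y₁ w ≡ true))
          refute z∉Y (inj₁ z∈Y₁) = true≢false (proj₁ (−-elim {S = Y} {y₀} {z} z∈Y₁)) z∉Y
          refute z∉Y (inj₂ (w , z~w , w∈Y₁)) = away (−-elim {S = Y} {y₀} {w} w∈Y₁)
            where
            away : ¬ (Y w ≡ true × y₀ ≢ w)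
            away (w∈Y , y₀≢w) = centre (star (𝕐.∈X z∉Y) w∈Y z~w)
              where
              centre : ¬ (z ≡ x₀ ⊎ w ≡ y₀)
              centre (inj₁ p) = adj⇒≢ G a (≡-sym p)
              centre (inj₂ p) = y₀≢w (≡-sym p)

      nbr-y : suc κ ≤ nbr Y₁ y + 2
      nbr-y = ≤-trans (≤-reflexive (trans (≡-sym deg-y) (≡-sym (nbr-∁ Y₁ y))))
        (+-monoʳ-≤ (nbr Y₁ y) (nbr≤length G {∁ Y₁} {y} (x₀ ∷ y₀ ∷ []) (λ z a p → member a (cases (Y z) inj₁ inj₂) (not-true p))))
        where
        member : ∀ {z} → y ~ z → Y z ≡ true ⊎ Y z ≡ false → Y₁ z ≡ false → z ∈ x₀ ∷ y₀ ∷ []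
        member a (inj₂ z∉Y) _ = here (from-y a (𝕐.∈X z∉Y))
        member {z} a (inj₁ z∈Y) z∉Y₁ with y₀ ≟ z
        ... | yes p = there (here (≡-sym p))
        ... | no y₀≢z = ⊥-elim (true≢false (∧-intro z∈Y refl) z∉Y₁)

      -- This is the curvature bound for the cut around Y − y₀.
      inner-y : nbr (int Y₁) y ≤ 1
      inner-y = ≮⇒≥ (λ gap → infeasible 0 (flat ⊕ nbr-y ⊕ gap ⊕ ≤-reflexive (≡-sym κ-value)) (eq κ (nbr Y₁ y) (nbr (int Y₁) y) s))
        where
        flat : nbr Y₁ y + nbr (int Y₁) y ≤ suc s + suc s
        flat = *-cancelˡ-≤ (suc κ) (begin
          suc κ * (nbr Y₁ y + nbr (int Y₁) y)     ≡⟨ cong (_* (nbr Y₁ y + nbr (int Y₁) y)) (≡-sym deg-x₀) ⟩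
          deg G x₀ * (nbr Y₁ y + nbr (int Y₁) y)  ≤⟨ curvature-cut Y₁ x₀~y x₀∉Y₁ y∈Y₁ ⟩
          deg G y * (nbr (cl Y₁) x₀ + nbr Y₁ x₀)  ≤⟨ *-monoʳ-≤ (deg G y) (+-mono-≤ closure
            (≤-trans (nbr-mono {Y₁} {Y} x₀ (λ z _ p → proj₁ (−-elim {S = Y} {y₀} {z} p))) (≤-reflexive nbr-x₀))) ⟩
          deg G y * (suc s + suc s)               ≡⟨ cong (_* (suc s + suc s)) deg-y ⟩
          suc κ * (suc s + suc s)                 ∎)
          where open ≤-Reasoning
        eq : ∀ κ n i s → n + i + (suc κ + (2 + (suc s + suc s))) ≡ suc (suc s + suc s + (n + 2 + (i + κ)) + 0)
        eq = solve-∀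

      module _ {t} (y₀~t : y₀ ~ t) (t∈int : int Y t ≡ true) where

        from-y₀ : ∀ {z} → y₀ ~ z → int Y z ≡ true → z ≡ t
        from-y₀ {z} a i with z ≟ t
        ... | yes p = p
        ... | no z≢t = ⊥-elim (<⇒≱ (length≤nbr G {int Y} {y₀} (z ∷ t ∷ []) ((z≢t ∷ []) ∷ [] ∷ []) ((a , i) ∷ (y₀~t , t∈int) ∷ [])) (≤-reflexive inn-y₀))

        at-t : Pred m
        at-t z = int Y z ∧ does (t ≟ z)

        -- Interior neighbours of `y` other than `t` do not see `y₀`, so they stay interior to
        -- `Y − y₀`, where `inner-y` allows only one. This forces both `y ~ t` and s = 1.
        inn-y≤ : suc s ≤ nbr at-t y + 1
        inn-y≤ = begin
          suc s                                                       ≡⟨ inn-y ⟨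
          𝕐.inn y                                                     ≡⟨ nbr-split (int Y) (λ z → does (t ≟ z)) y ⟩
          nbr at-t y + nbr (λ z → int Y z ∧ not (does (t ≟ z))) y     ≤⟨ +-monoʳ-≤ (nbr at-t y) (≤-trans (nbr-mono {int Y − t} {int Y₁} y keep) inner-y) ⟩
          nbr at-t y + 1                                              ∎
          where
          open ≤-Reasoning
          keep : ∀ z → y ~ z → (int Y − t) z ≡ true → int Y₁ z ≡ true
          keep z _ p = stay (−-elim {S = int Y} {t} {z} p)
            where
            stay : int Y z ≡ true × t ≢ z → int Y₁ z ≡ true
            stay (i , t≢z) = int-intro {Y₁} {z}
              (−-intro {S = Y} {y₀} {z} (int⊆ {Y} i) (λ { refl → true≢false i (𝕐.rim∉int rim-y₀) }))
              (λ w a → −-intro {S = Y} {y₀} {w} (int-nbr {Y} {z} {w} i a) (λ { refl → t≢z (≡-sym (from-y₀ (adj-sym a) i)) }))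

        at-t-elim : ∀ {z} → at-t z ≡ true → t ≡ z
        at-t-elim {z} p = ≟-true {x = t} {z} (∧-snd {int Y z} p)

        y~t : y ~ t
        y~t = cases (adj G y t) (λ a → a) (λ ¬a → ⊥-elim (<⇒≱ 1≤s (+-cancelˡ-≤ 1 s 0
          (subst (λ c → suc s ≤ c + 1) (nbr-none at-t y (λ z a p → true≢false (subst (y ~_) (≡-sym (at-t-elim p)) a) ¬a)) inn-y≤))))

        s≡1 : s ≡ 1
        s≡1 = ≤-antisym (+-cancelˡ-≤ 1 s 1 (≤-trans inn-y≤
          (+-monoˡ-≤ 1 (nbr≤length G {at-t} {y} (t ∷ []) (λ z a p → here (≡-sym (at-t-elim p))))))) 1≤s

    module _ {t} (y₀~t : y₀ ~ t) (t∈int : int Y t ≡ true) where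

      private
        rim-y₁ : 𝕐.rim y₁ ≡ true
        rim-y₁ = 𝕐.rim-intro y₁∈Y (adj-sym x₀~y₁) x₀∈X

        s≡1 : s ≡ 1
        s≡1 = Leaf.s≡1 rim-y₁ y₁≢y₀ y₀~t t∈int

        κ≡4 : κ ≡ 4
        κ≡4 = trans κ-value (cong (λ t → suc t + suc t) s≡1)

        k≡3 : k ≡ 3
        k≡3 = +-cancelˡ-≡ 1 _ _ (trans (cong (_+ k) (≡-sym s≡1)) (trans κ≡s+k κ≡4))

        5≤deg : ∀ v → 5 ≤ deg G v
        5≤deg v = subst (λ c → suc c ≤ deg G v) κ≡4 (κ<deg v)

      open Descent G curvature-cut 5≤deg using (Ladder; no-ladder)

      module _ {q r} (rim-q : 𝕐.rim q ≡ true) (q≢y₀ : q ≢ y₀) (rim-r : 𝕐.rim r ≡ true) (r≢y₀ : r ≢ y₀) (q≢r : q ≢ r) where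

        rim⊆ : ∀ {z} → 𝕐.rim z ≡ true → z ∈ y₀ ∷ q ∷ r ∷ []
        rim⊆ {z} e = decide (z ∈? (y₀ ∷ q ∷ r ∷ []))
          where
          decide : Dec (z ∈ y₀ ∷ q ∷ r ∷ []) → z ∈ y₀ ∷ q ∷ r ∷ []
          decide (yes p) = p
          decide (no ¬p) = ⊥-elim (<⇒≱ (length≤count 𝕐.rim (z ∷ y₀ ∷ q ∷ r ∷ [])
            (((λ p → ¬p (here p)) ∷ (λ p → ¬p (there (here p))) ∷ (λ p → ¬p (there (there (here p)))) ∷ [])
              ∷ ((λ p → q≢y₀ (≡-sym p)) ∷ (λ p → r≢y₀ (≡-sym p)) ∷ []) ∷ (q≢r ∷ []) ∷ [] ∷ [])
            (e ∷ rim-y₀ ∷ rim-q ∷ rim-r ∷ [])) (≤-reflexive k≡3))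

        Rail : Fin m → Fin m → Set
        Rail y y′ = y ~ y′ × int Y y′ ≡ true × y′ ≢ t × (∀ {z} → y ~ z → int Y z ≡ true → z ∈ t ∷ y′ ∷ [])

        rail : ∀ {y} → 𝕐.rim y ≡ true → y ≢ y₀ → ∃ (Rail y)
        rail {y} e y≢y₀ = extend (nbr-fresh G {int Y} {y} (t ∷ []) (≤-reflexive (≡-sym inn≡2)))
          where
          inn≡2 : 𝕐.inn y ≡ 2
          inn≡2 = trans (Leaf.inn-y e y≢y₀) (cong suc s≡1)
          extend : (∃ λ y′ → y ~ y′ × int Y y′ ≡ true × y′ ∉ t ∷ []) → ∃ (Rail y)
          extend (y′ , a , i , y′∉) = y′ , a , i , (λ p → y′∉ (here p)) , λ {z} b j → exhaust b j (z ∈? (t ∷ y′ ∷ []))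
            where
            exhaust : ∀ {z} → y ~ z → int Y z ≡ true → Dec (z ∈ t ∷ y′ ∷ []) → z ∈ t ∷ y′ ∷ []
            exhaust b j (yes p) = p
            exhaust {z} b j (no ¬p) = ⊥-elim (<⇒≱ (length≤nbr G {int Y} {y} (z ∷ t ∷ y′ ∷ [])
              (((λ p → ¬p (here p)) ∷ (λ p → ¬p (there (here p))) ∷ []) ∷ ((λ p → y′∉ (here (≡-sym p))) ∷ []) ∷ [] ∷ [])
              ((b , j) ∷ (Leaf.y~t e y≢y₀ y₀~t t∈int , t∈int) ∷ (a , i) ∷ [])) (≤-reflexive inn≡2))

        -- The first rung: the centre `y₀` contributes one edge into the interior and each of the
        -- two leaves contributes two.
        ladder : ∀ {q′ r′} → Rail q q′ → Rail r r′ → Ladder (int Y) y₀ q r t q′ r′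
        ladder (q~q′ , q′∈ , q′≢t , from-q) (r~r′ , r′∈ , r′≢t , from-r) = record
          { p∉T = 𝕐.rim∉int rim-y₀ ; q∉T = 𝕐.rim∉int rim-q ; r∉T = 𝕐.rim∉int rim-r
          ; p≢q = q≢y₀ ∘ ≡-sym ; p≢r = r≢y₀ ∘ ≡-sym ; q≢r = q≢r
          ; boundary = λ a i j → rim⊆ (∧-intro (int-nbr {Y} i a) (cong not j))
          ; t∈T = t∈int ; q′∈T = q′∈ ; r′∈T = r′∈
          ; p~t = y₀~t
          ; q~t = Leaf.y~t rim-q q≢y₀ y₀~t t∈int ; r~t = Leaf.y~t rim-r r≢y₀ y₀~t t∈int
          ; q~q′ = q~q′ ; r~r′ = r~r′ ; q′≢t = q′≢t ; r′≢t = r′≢t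
          ; from-p = Leaf.from-y₀ rim-q q≢y₀ y₀~t t∈int ; from-q = from-q ; from-r = from-r
          ; deg-q = trans (Leaf.deg-y rim-q q≢y₀) (cong suc κ≡4)
          ; deg-r = trans (Leaf.deg-y rim-r r≢y₀) (cong suc κ≡4) }

        collapse : ∃ (Rail q) → ∃ (Rail r) → ⊥
        collapse (_ , railq) (_ , railr) = no-ladder (ladder railq railr)
          -- A part of the interior misses `y₀`, so it is a proper part of `Y` and has more than
          -- four outgoing edges.
          (λ S v S⊆ v∈S → subst (λ c → suc c ≤ cut S) κ≡4 (strict S (λ z p → int⊆ {Y} (S⊆ z p)) v y₀ v∈S y₀∈Y
            (¬-not (λ p → true≢false (S⊆ y₀ p) (𝕐.rim∉int rim-y₀)))))

      absurd-at : ⊥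
      absurd-at = pick₁ (fresh 𝕐.rim (y₀ ∷ []) (subst (1 <_) (≡-sym k≡3) (s≤s (s≤s z≤n))))
        where
        pick₂ : ∀ {q} → 𝕐.rim q ≡ true → q ∉ y₀ ∷ [] → (∃ λ r → 𝕐.rim r ≡ true × r ∉ y₀ ∷ q ∷ []) → ⊥
        pick₂ {q} e q∉ (r , e′ , r∉) = collapse e q≢ e′ r≢ q≢r (rail e q≢ e′ r≢ q≢r e q≢) (rail e q≢ e′ r≢ q≢r e′ r≢)
          where
          q≢ = λ p → q∉ (here p)
          r≢ = λ p → r∉ (here p)
          q≢r = λ p → r∉ (there (here (≡-sym p)))
        pick₁ : (∃ λ q → 𝕐.rim q ≡ true × q ∉ y₀ ∷ []) → ⊥
        pick₁ (q , e , q∉) = pick₂ e q∉ (fresh 𝕐.rim (y₀ ∷ q ∷ []) (subst (2 <_) (≡-sym k≡3) (s≤s (s≤s (s≤s z≤n)))))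

    absurd : ⊥
    absurd = let t , a , i , _ = nbr-fresh G {int Y} {y₀} [] (≤-reflexive (≡-sym inn-y₀)) in absurd-at a i

  no-minimal-cut : Minimal → StrictlyMinimal → ∀ {x y} → X x ≡ true → Y y ≡ true → x ~ y → ⊥
  no-minimal-cut minimal strict {x} {y} x∈X y∈Y x~y = find-y₁
    (Σ-<⇒∃< (λ u → ⟦ Y u ⟧ * 𝕐.out u) (λ u → ⟦ 𝕐.rim u ⟧ * 𝕐.inn u) (subst (κ <_) 𝕐.cut-int κ<cut-int))
    where
    rim-y = 𝕐.rim-intro y∈Y (adj-sym x~y) x∈X
    rim-x = 𝕏.rim-intro x∈X x~y y∈Y
    κ<cut-int : κ < cut (int Y)
    κ<cut-int = let z , i = 𝕐.inhabited rim-y in strict (int Y) (λ w → int⊆ {Y}) z y i y∈Y (𝕐.rim∉int rim-y)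
    -- For `X` minimality gives only a weak inequality between the sums. It still produces `x₁`,
    -- because at `x₀` the cut edges strictly outnumber the inner neighbours.
    κ≤cut-int : Σℕ (λ u → ⟦ X u ⟧ * 𝕏.out u) ≤ Σℕ (λ u → ⟦ 𝕏.rim u ⟧ * 𝕏.inn u)
    κ≤cut-int = let z , i = 𝕏.inhabited rim-x in subst₂ _≤_ (edges-sym Y X) 𝕏.cut-int
      (minimal (int X) z x i (𝕏.rim∉int rim-x))
    find-y₁ : (∃ λ y₁ → ⟦ Y y₁ ⟧ * 𝕐.out y₁ < ⟦ 𝕐.rim y₁ ⟧ * 𝕐.inn y₁) → ⊥
    find-y₁ (y₁ , lt) = find-x₁ (Σ-≤⇒∃< (λ u → ⟦ X u ⟧ * 𝕏.out u) (λ u → ⟦ 𝕏.rim u ⟧ * 𝕏.inn u) κ≤cut-int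
      (𝕏.inn<out (𝕏.rim-intro x₀∈X x₀~y₁ y₁∈Y) (Forth.flip x₀∈X y₁∈Y x₀~y₁ surplus)))
      where
      rim-y₁ = proj₁ (𝕐.out<inn lt)
      surplus = proj₂ (𝕐.out<inn lt)
      y₁∈Y = 𝕐.rim⊆Y rim-y₁
      x₀~y₁ = adj-sym (proj₁ (proj₂ (𝕐.rim-elim rim-y₁)))
      x₀∈X = proj₂ (proj₂ (𝕐.rim-elim rim-y₁))
      find-x₁ : (∃ λ x₁ → ⟦ X x₁ ⟧ * 𝕏.out x₁ < ⟦ 𝕏.rim x₁ ⟧ * 𝕏.inn x₁) → ⊥
      find-x₁ (x₁ , lt₁) = let rim-x₁ , surplus₁ = 𝕏.out<inn lt₁ ; y₀ , a , y₀∈Y = 𝕏.rim-elim rim-x₁ in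
        DoubleStar.absurd strict x₀∈X y₁∈Y x₀~y₁ surplus (𝕏.rim⊆Y rim-x₁) y₀∈Y a surplus₁

-- Edge cuts

not-∨ : ∀ a b → not (a ∨ b) ≡ not a ∧ not b
not-∨ true  b = refl
not-∨ false b = refl

crossing : ∀ {a : Fin m → Fin m → Bool} (S : Pred m) {u v} → Walk a u v → S u ≡ true → S v ≡ false →
  ∃ λ x → ∃ λ y → a x y ≡ true × S x ≡ true × S y ≡ false
crossing S here u∈S u∉S = ⊥-elim (true≢false u∈S u∉S)
crossing S (step {u} {w} a walk) u∈S v∉S = cases (S w)
  (λ w∈S → crossing S walk w∈S v∉S) (λ w∉S → u , w , a , u∈S , w∉S)

snoc : ∀ {a : Fin m → Fin m → Bool} {x u v} → Walk a x u → a u v ≡ true → Walk a x v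
snoc here       b = step b here
snoc (step c w) b = step c (snoc w b)

-- Bridges `cut`, a sum over ordered pairs, and `edgeCount`, which counts each edge once with u < v.
Σ-pairs : (g : Fin m → Fin m → ℕ) → (∀ i → g i i ≡ 0) →
  Σℕ (λ u → Σℕ (λ v → g u v)) ≡ Σℕ (λ u → Σℕ (λ v → ⟦ does (u <? v) ⟧ * (g u v + g v u)))
Σ-pairs g diagonal = begin
  Σℕ (λ u → Σℕ (λ v → g u v))
    ≡⟨ Σ-cong (λ u → trans (Σ-cong (λ v → split u v)) (Σ-+ (below u) (λ v → ⟦ does (v <? u) ⟧ * g u v))) ⟩
  Σℕ (λ u → Σℕ (below u) + Σℕ (λ v → ⟦ does (v <? u) ⟧ * g u v))
    ≡⟨ Σ-+ (λ u → Σℕ (below u)) (λ u → Σℕ (λ v → ⟦ does (v <? u) ⟧ * g u v)) ⟩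
  Σℕ (λ u → Σℕ (below u)) + Σℕ (λ u → Σℕ (λ v → ⟦ does (v <? u) ⟧ * g u v))
    ≡⟨ cong (Σℕ (λ u → Σℕ (below u)) +_) (Σ-swap (λ u v → ⟦ does (v <? u) ⟧ * g u v)) ⟩
  Σℕ (λ u → Σℕ (below u)) + Σℕ (λ u → Σℕ (λ v → ⟦ does (u <? v) ⟧ * g v u))
    ≡⟨ Σ-+ (λ u → Σℕ (below u)) (λ u → Σℕ (λ v → ⟦ does (u <? v) ⟧ * g v u)) ⟨
  Σℕ (λ u → Σℕ (below u) + Σℕ (λ v → ⟦ does (u <? v) ⟧ * g v u))
    ≡⟨ Σ-cong (λ u → trans (≡-sym (Σ-+ (below u) (λ v → ⟦ does (u <? v) ⟧ * g v u)))
         (Σ-cong (λ v → ≡-sym (*-distribˡ-+ ⟦ does (u <? v) ⟧ (g u v) (g v u))))) ⟩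
  Σℕ (λ u → Σℕ (λ v → ⟦ does (u <? v) ⟧ * (g u v + g v u))) ∎
  where
  open ≡-Reasoning
  below : Fin _ → Fin _ → ℕ
  below u v = ⟦ does (u <? v) ⟧ * g u v
  split : ∀ u v → g u v ≡ below u v + ⟦ does (v <? u) ⟧ * g u v
  split u v with <-cmp u v
  ... | tri< lt _ ¬gt rewrite dec-true (u <? v) lt | dec-false (v <? u) ¬gt = eq (g u v)
    where
    eq : ∀ k → k ≡ 1 * k + 0 * k
    eq = solve-∀
  ... | tri> ¬lt _ gt rewrite dec-false (u <? v) ¬lt | dec-true (v <? u) gt = eq (g u v)
    where
    eq : ∀ k → k ≡ 0 * k + 1 * k
    eq = solve-∀
  ... | tri≈ _ refl _ rewrite diagonal u | *-zeroʳ ⟦ does (u <? u) ⟧ = refl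

module _ {m : ℕ} (G : SimpleGraph m) where
  open Neighbourhoods G

  edgeCount≡Σ : ∀ F → edgeCount G F ≡ Σℕ (λ u → Σℕ (λ v → ⟦ does (u <? v) ⟧ * ⟦ inSet G F u v ⟧))
  edgeCount≡Σ F = Σ-cong (λ u → trans (count≡Σ (λ v → does (u <? v) ∧ inSet G F u v))
    (Σ-cong (λ v → ⟦∧⟧ (does (u <? v)) (inSet G F u v))))

  inSet-sym : ∀ F u v → inSet G F u v ≡ inSet G F v u
  inSet-sym F u v = cong₂ _∧_ (sym G u v) (Bool.∨-comm (F u v) (F v u))

  cut≤edgeCount : ∀ F S → (∀ u v → S u ≡ true → S v ≡ false → deleteEdges G F u v ≡ false) → cut S ≤ edgeCount G F
  cut≤edgeCount F S closed = begin
    cut S                                                             ≡⟨ Σ-cong (λ u → trans (cong (⟦ S u ⟧ *_) (nbr≡Σ (∁ S) u))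
                                                                           (≡-sym (Σ-*ˡ ⟦ S u ⟧ (λ v → ⟦ adj G u v ⟧ * ⟦ ∁ S v ⟧)))) ⟩
    Σℕ (λ u → Σℕ (λ v → g u v))                                       ≡⟨ Σ-pairs g diagonal ⟩
    Σℕ (λ u → Σℕ (λ v → ⟦ does (u <? v) ⟧ * (g u v + g v u)))         ≤⟨ Σ-mono (λ u → Σ-mono (λ v → *-monoʳ-≤ ⟦ does (u <? v) ⟧ (pointwise u v))) ⟩
    Σℕ (λ u → Σℕ (λ v → ⟦ does (u <? v) ⟧ * ⟦ inSet G F u v ⟧))       ≡⟨ edgeCount≡Σ F ⟨
    edgeCount G F                                                     ∎
    where
    open ≤-Reasoning
    g : Fin m → Fin m → ℕ
    g u v = ⟦ S u ⟧ * (⟦ adj G u v ⟧ * ⟦ ∁ S v ⟧)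
    diagonal : ∀ u → g u u ≡ 0
    diagonal u rewrite irrefl G u = *-zeroʳ ⟦ S u ⟧
    deleted : ∀ a f → a ∧ not f ≡ false → ⟦ a ⟧ ≤ ⟦ a ∧ f ⟧
    deleted false f     _ = z≤n
    deleted true  true  _ = ≤-refl
    leaving : ∀ u v → S u ≡ true → S v ≡ false → ⟦ adj G u v ⟧ ≤ ⟦ inSet G F u v ⟧
    leaving u v u∈S v∉S = deleted (adj G u v) (F u v ∨ F v u) (closed u v u∈S v∉S)
    pointwise : ∀ u v → g u v + g v u ≤ ⟦ inSet G F u v ⟧
    pointwise u v with S u in u∈S | S v in v∈S
    ... | true  | true  = subst (_≤ ⟦ inSet G F u v ⟧) (≡-sym (eq ⟦ adj G u v ⟧ ⟦ adj G v u ⟧)) z≤n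
      where
      eq : ∀ a b → 1 * (a * 0) + 1 * (b * 0) ≡ 0
      eq = solve-∀
    ... | true  | false = subst (_≤ ⟦ inSet G F u v ⟧) (≡-sym (eq ⟦ adj G u v ⟧ ⟦ adj G v u ⟧)) (leaving u v u∈S v∈S)
      where
      eq : ∀ a b → 1 * (a * 1) + 0 * (b * 0) ≡ a
      eq = solve-∀
    ... | false | true  = subst₂ _≤_ (≡-sym (eq ⟦ adj G u v ⟧ ⟦ adj G v u ⟧)) (cong ⟦_⟧ (inSet-sym F v u)) (leaving v u v∈S u∈S)
      where
      eq : ∀ a b → 0 * (a * 0) + 1 * (b * 1) ≡ b
      eq = solve-∀
    ... | false | false = z≤n

  starOf : Fin m → Fin m → Fin m → Bool
  starOf x u v = does (x ≟ u)

  edgeCount-star : ∀ x → edgeCount G (starOf x) ≡ deg G x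
  edgeCount-star x = begin
    edgeCount G (starOf x)                                                  ≡⟨ edgeCount≡Σ (starOf x) ⟩
    Σℕ (λ u → Σℕ (λ v → ⟦ does (u <? v) ⟧ * ⟦ inSet G (starOf x) u v ⟧))    ≡⟨ Σ-cong (λ u → Σ-cong (λ v → cong (⟦ does (u <? v) ⟧ *_) (pointwise u v))) ⟩
    Σℕ (λ u → Σℕ (λ v → ⟦ does (u <? v) ⟧ * (g u v + g v u)))               ≡⟨ Σ-pairs g diagonal ⟨
    Σℕ (λ u → Σℕ (λ v → g u v))                                             ≡⟨ Σ-cong (λ u → trans (Σ-*ˡ ⟦ does (x ≟ u) ⟧ (λ v → ⟦ adj G u v ⟧))
                                                                                 (cong (⟦ does (x ≟ u) ⟧ *_) (≡-sym (count≡Σ (adj G u))))) ⟩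
    Σℕ (λ u → ⟦ does (x ≟ u) ⟧ * deg G u)                                   ≡⟨ Σ-point x (deg G) ⟩
    deg G x                                                                 ∎
    where
    open ≡-Reasoning
    g : Fin m → Fin m → ℕ
    g u v = ⟦ does (x ≟ u) ⟧ * ⟦ adj G u v ⟧
    diagonal : ∀ u → g u u ≡ 0
    diagonal u rewrite irrefl G u = *-zeroʳ ⟦ does (x ≟ u) ⟧
    pointwise : ∀ u v → ⟦ inSet G (starOf x) u v ⟧ ≡ g u v + g v u
    pointwise u v with x ≟ u | x ≟ v
    ... | yes refl | yes refl rewrite irrefl G x = refl
    ... | yes refl | no _     rewrite Bool.∧-identityʳ (adj G x v) = ≡-sym (trans (+-identityʳ _) (*-identityˡ _))
    ... | no _     | yes refl rewrite Bool.∧-identityʳ (adj G u x) | sym G u x = ≡-sym (*-identityˡ _)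
    ... | no _     | no _     rewrite Bool.∧-zeroʳ (adj G u v) = refl

  star-isEdgeCut : ∀ {x y} → x ≢ y → IsEdgeCut G (starOf x)
  star-isEdgeCut {x} {y} x≢y connected = blocked (connected x y) x≢y
    where
    blocked : ∀ {z} → Walk (deleteEdges G (starOf x)) x z → x ≢ z → ⊥
    blocked here x≢x = x≢x refl
    blocked (step {y = z} a _) _ = true≢false (∧-snd {adj G x z} a) (cong (λ b → not (b ∨ does (x ≟ z))) (≟-refl x))

  module _ (d : ℕ) (large : ∀ S {u v} → S u ≡ true → S v ≡ false → d ≤ cut S) where

    -- The set of vertices reached from `x` grows along surviving edges. If it got stuck before `y`,
    -- all edges leaving it would be in `F`, and there are at least `d` of them.
    connected-after : ∀ F → edgeCount G F < d → ConnectedAdj (deleteEdges G F)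
    connected-after F few x y = grow (λ z → does (x ≟ z)) (<-wellFounded _) (≟-refl x)
      (λ z p → subst (Walk _ x) (≟-true {x = x} {z} p) here)
      where
      grow : (S : Pred m) → Acc _<_ (count (∁ S)) → S x ≡ true → (∀ z → S z ≡ true → Walk (deleteEdges G F) x z) →
        Walk (deleteEdges G F) x y
      grow S (acc rec) x∈S reached = cases (S y) (reached y) extend
        where
        Exit : Set
        Exit = ∃ λ u → ∃ λ v → (S u ≡ true × S v ≡ false) × deleteEdges G F u v ≡ true
        exit? : Dec Exit
        exit? = any? (λ u → any? (λ v → ((S u Bool.≟ true) ×-dec (S v Bool.≟ false)) ×-dec (deleteEdges G F u v Bool.≟ true)))
        extend : S y ≡ false → Walk (deleteEdges G F) x y
        extend y∉S = decide exit?
          where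
          decide : Dec Exit → Walk (deleteEdges G F) x y
          decide (no ¬exit) = ⊥-elim (<⇒≱ few (≤-trans (large S x∈S y∉S)
            (cut≤edgeCount F S (λ u v u∈S v∉S → ¬-not (λ p → ¬exit (u , v , (u∈S , v∉S) , p))))))
          decide (yes (u , v , (u∈S , v∉S) , p)) = grow S⁺ (rec fewer) (cong (_∨ does (v ≟ x)) x∈S) reached⁺
            where
            S⁺ : Pred m
            S⁺ z = S z ∨ does (v ≟ z)
            reached⁺ : ∀ z → S⁺ z ≡ true → Walk (deleteEdges G F) x z
            reached⁺ z q = cases (S z) (reached z)
              (λ z∉S → subst (Walk _ x) (≟-true {x = v} {z} (trans (cong (_∨ does (v ≟ z)) (≡-sym z∉S)) q)) (snoc (reached u u∈S) p))
            fewer : count (∁ S⁺) < count (∁ S)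
            fewer = subst (count (∁ S⁺) <_) (≡-sym (count-− (∁ S) v (cong not v∉S)))
              (s≤s (count-mono {f = ∁ S⁺} {∁ S − v} (λ z q → trans (≡-sym (not-∨ (S z) (does (v ≟ z)))) q)))

    edgeCut≥ : ∀ F → IsEdgeCut G F → d ≤ edgeCount G F
    edgeCut≥ F isCut = ≮⇒≥ (λ few → isCut (connected-after F few))

-- Induction to an extremal cut and conclusion

module _ {n : ℕ} (G : SimpleGraph (suc n)) (connected : Connected G) (nonNeg : NonNegLLY G) where
  open Neighbourhoods G

  deg<m : ∀ v → deg G v < suc n
  deg<m v = ≤-trans (s≤s (count-mono {f = adj G v} {everything − v} (λ z a → −-intro {S = everything} {v} {z} refl (adj⇒≢ G a))))
    (≤-trans (≤-reflexive (≡-sym (count-− everything v refl))) (count≤m everything))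
    where
    everything : Pred (suc n)
    everything _ = true

  no-minimal-small-cut : ∀ Y {u v} → Y u ≡ true → Y v ≡ false → cut Y < minDeg G →
    (∀ S a b → S a ≡ true → S b ≡ false → cut Y ≤ cut S) →
    (∀ S → (∀ z → S z ≡ true → Y z ≡ true) → ∀ a b → S a ≡ true → Y b ≡ true → S b ≡ false → cut Y < cut S) → ⊥
  no-minimal-small-cut Y {u} {v} u∈Y v∉Y small minimal strict = contradict (crossing Y (connected u v) u∈Y v∉Y)
    where
    κ<deg : ∀ w → cut Y < deg G w
    κ<deg w = ≤-trans small (minDeg-≤ G w)
    contradict : ¬ (∃ λ y → ∃ λ x → adj G y x ≡ true × Y y ≡ true × Y x ≡ false)
    contradict (y , x , y~x , y∈Y , x∉Y) = Extremal.no-minimal-cut G (Curvature.curvature-cut G nonNeg 3≤m) Y κ<deg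
      minimal strict (cong not x∉Y) y∈Y (adj-sym y~x)
      where
      1≤κ : 1 ≤ cut Y
      1≤κ = ≤-trans (subst (λ b → 1 ≤ ⟦ b ⟧ * nbr (∁ Y) y) (≡-sym y∈Y)
          (≤-trans (length≤nbr G {∁ Y} {y} (x ∷ []) ([] ∷ []) ((y~x , cong not x∉Y) ∷ [])) (≤-reflexive (≡-sym (*-identityˡ _)))))
        (Σ-≥ (λ w → ⟦ Y w ⟧ * nbr (∁ Y) w) y)
      -- Connectedness makes the cut non-empty, so degrees are at least 2 and there is room for the
      -- three levels of the height function.
      3≤m : 3 ≤ suc n
      3≤m = ≤-trans (s≤s (≤-trans (s≤s 1≤κ) (κ<deg y))) (deg<m y)

  -- Lexicographic descent, first on the cut size and then on the set. The bound `k` stays fixed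
  -- while only the set shrinks, so that step needs just `cut S ≤ cut Y`.
  no-small-cut : ∀ {k} Y {u v} → Acc _<_ k → Acc _<_ (count Y) → cut Y ≤ k →
    Y u ≡ true → Y v ≡ false → cut Y < minDeg G → ⊥
  no-small-cut Y below-k@(acc smaller-cut) (acc smaller-set) cut≤k u∈Y v∉Y small = no-minimal-small-cut Y u∈Y v∉Y small
    (λ S a b a∈S b∉S → ≮⇒≥ (λ lt →
      no-small-cut S (smaller-cut (≤-trans lt cut≤k)) (<-wellFounded (count S)) ≤-refl a∈S b∉S (<-trans lt small)))
    (λ S S⊆Y a b a∈S b∈Y b∉S → ≰⇒> (λ le →
      no-small-cut S below-k (smaller-set (fewer S⊆Y b∈Y b∉S)) (≤-trans le cut≤k) a∈S b∉S (≤-<-trans le small)))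
    where
    fewer : ∀ {S b} → (∀ z → S z ≡ true → Y z ≡ true) → Y b ≡ true → S b ≡ false → count S < count Y
    fewer {S} {b} S⊆Y b∈Y b∉S = subst (count S <_) (≡-sym (count-− Y b b∈Y))
      (s≤s (count-mono {f = S} {Y − b} (λ z p → −-intro {S = Y} {b} {z} (S⊆Y z p) (λ { refl → true≢false p b∉S }))))

  minDeg≤cut : ∀ S {u v} → S u ≡ true → S v ≡ false → minDeg G ≤ cut S
  minDeg≤cut S u∈S v∉S = ≮⇒≥ (no-small-cut S (<-wellFounded (cut S)) (<-wellFounded (count S)) ≤-refl u∈S v∉S)

theorem1p2 : ∀ {n : ℕ} (G : SimpleGraph (suc n)) → Connected G → NonNegLLY G →
    EdgeConnectivityIs G (minDeg G)
theorem1p2 {zero} G connected nonNeg = cong (λ b → ⟦ b ⟧ + 0) (irrefl G zero)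
theorem1p2 {suc n} G connected nonNeg =
  (starOf G x , star-isEdgeCut G (proj₂ (other x)) , trans (edgeCount-star G x) (proj₂ (minDeg-attained G))) ,
  edgeCut≥ G (minDeg G) (minDeg≤cut G connected nonNeg)
  where
  x = proj₁ (minDeg-attained G)
  other : (x : Fin (suc (suc n))) → ∃ λ y → x ≢ y
  other zero    = suc zero , λ ()
  other (suc _) = zero , λ ()
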